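{- Let $T=\{1324,3142,3412\}$. Then $$F_T(x)=\frac{1-9x+30x^2-44x^3+27x^4-7x^5}{(1-3x)(1-x)(1-3x+x^2)^2}.$$
   Context: $S_n(T)$ denotes the set of permutations $\pi$ of $[n]=\{1,\dots,n\}$ (one-line notation) that avoid every pattern $\tau\in T$, i.e. no subsequence of $\pi$ is order-isomorphic to $\tau$. $F_T(x)=\sum_{n\ge 0}|S_n(T)|x^n$, a formal power series, with $|S_0(T)|=1$. -}

module Defs where

open import Data.Fin.Base using (cast)
open import Data.Fin.Properties using (all?)
open import Data.Integer.Base as ℤ using (ℤ; +_; 0ℤ; 1ℤ)
open import Data.List.Base using (List; []; _∷_; [_]; length; lookup; map; upTo; filter; foldr; cartesianProductWith)
import Data.List.Relation.Unary.All as All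
open import Data.List.Relation.Unary.All using (All)
open import Data.List.Relation.Binary.Sublist.Propositional using (_⊆_; []; _∷_; _∷ʳ_)
open import Data.Nat.Base using (ℕ; zero; suc; _∸_; _<_)
open import Data.Nat.Properties using (_≟_; _<?_; ≡-decSetoid)
open import Data.List.Relation.Unary.Unique.DecSetoid ≡-decSetoid using (unique?)
open import Data.Product.Base using (Σ; ∃-syntax; _×_; _,_; uncurry)
open import Data.Sum.Base using (inj₁; inj₂; [_,_]′)
open import Function.Base using (_∘_)
open import Function.Bundles using (_⇔_; mk⇔; module Equivalence)
open import Relation.Binary.PropositionalEquality using (_≡_; refl)
open import Relation.Nullary using (Dec; yes; no; ¬_)
open import Relation.Nullary.Decidable using (map′; ¬?; _×-dec_; _⊎-dec_; _→-dec_)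
open import Relation.Unary using (Decidable)

OrderIsomorphic : List ℕ → List ℕ → Set
OrderIsomorphic σ τ =
  Σ (length σ ≡ length τ) λ eq →
    ∀ i j → (lookup σ i < lookup σ j) ⇔ (lookup τ (cast eq i) < lookup τ (cast eq j))

Contains : List ℕ → List ℕ → Set
Contains π τ = ∃[ σ ] (σ ⊆ π × OrderIsomorphic σ τ)

Avoids : List (List ℕ) → List ℕ → Set
Avoids T π = All (λ τ → ¬ Contains π τ) T

orderIsomorphic? : ∀ σ τ → Dec (OrderIsomorphic σ τ)
orderIsomorphic? σ τ with length σ ≟ length τ
... | no  neq = no λ (eq , _) → neq eq
... | yes eq  =
  map′ (eq ,_) (λ (_ , iso) → iso)
    (all? λ i → all? λ j →
      (lookup σ i <? lookup σ j) ⇔? (lookup τ (cast eq i) <? lookup τ (cast eq j)))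
  where
  _⇔?_ : {A B : Set} → Dec A → Dec B → Dec (A ⇔ B)
  a? ⇔? b? =
    map′ (uncurry mk⇔) (λ e → Equivalence.to e , Equivalence.from e)
      ((a? →-dec b?) ×-dec (b? →-dec a?))

anySublist? : {P : List ℕ → Set} → Decidable P → ∀ xs → Dec (∃[ σ ] (σ ⊆ xs × P σ))
anySublist? P? [] = map′ (λ p → [] , [] , p) (λ { (_ , [] , p) → p }) (P? [])
anySublist? P? (x ∷ xs) =
  map′
    [ (λ (_ , s , p) → _ , refl ∷ s , p) , (λ (_ , s , p) → _ , x ∷ʳ s , p) ]′
    (λ { (_ , refl ∷ s , p) → inj₁ (_ , s , p) ; (_ , _ ∷ʳ s , p) → inj₂ (_ , s , p) })
    (anySublist? (P? ∘ (x ∷_)) xs ⊎-dec anySublist? P? xs)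

avoids? : ∀ T → Decidable (Avoids T)
avoids? T π = All.all? (λ τ → ¬? (anySublist? (λ σ → orderIsomorphic? σ τ) π)) T

words : ℕ → List ℕ → List (List ℕ)
words zero    xs = [ [] ]
words (suc k) xs = cartesianProductWith _∷_ xs (words k xs)

-- Permutations of {1, …, n} in one-line notation: the length-n words over
-- {1, …, n} without repeated letters.
permutations : ℕ → List (List ℕ)
permutations n = filter unique? (words n (map suc (upTo n)))

-- Both `permutations n` and `S n T` list each of their elements exactly once,
-- so `length (S n T)` is the cardinality of Sₙ(T).
S : ℕ → List (List ℕ) → List (List ℕ)
S n T = filter (avoids? T) (permutations n)

-- Formal power series over ℤ, given by their coefficients.
Series : Set
Series = ℕ → ℤ

infixl 7 _⊛_
infixr 8 _^_
infix  4 _≈_÷_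

poly : List ℤ → Series
poly []       n       = 0ℤ
poly (c ∷ cs) zero    = c
poly (c ∷ cs) (suc n) = poly cs n

_⊛_ : Series → Series → Series
(f ⊛ g) n = foldr ℤ._+_ 0ℤ (map (λ i → f i ℤ.* g (n ∸ i)) (upTo (suc n)))

_^_ : Series → ℕ → Series
f ^ zero  = poly (1ℤ ∷ [])
f ^ suc k = f ⊛ f ^ k

-- f is the quotient p / q in ℤ[[x]].  A q with constant term 1 is invertible,
-- so the second component determines f.
_≈_÷_ : Series → Series → Series → Set
f ≈ p ÷ q = q 0 ≡ 1ℤ × (∀ n → (q ⊛ f) n ≡ p n)

F : List (List ℕ) → Series
F T n = + length (S n T)

{-# OPTIONS --safe #-}
module Submission where

-- Split a word at its first letter a.  If a is the largest letter, the rest is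
-- any avoider.  Otherwise the rest is P ++ W, where W starts with the first
-- letter above a: P lies below a and avoids 132 and 3412, while W shuffles a
-- descending word on letters below P into a word on the letters above a that
-- avoids 213 and 3412.  Only a letter that starts no 231 leaves room for small
-- letters before the end, so W is again built letter by letter: its first large
-- letter is the largest, the smallest, or forces all smaller letters to descend
-- at the end.  With C counting Av(213, 3412), which equals Av(132, 3412) up to
-- reverse-complement, S the partial sums of C without its constant term, and H
-- counting the shuffles W by total length,
--   (1 − x) F = 1 + x C H,   (1 − 3x + x²) C = 1 − 2x,
--   (1 − 3x) H = x + x² S,   (1 − 3x + x²) S = x.

open import Defs
open import Algebra.Bundles using (CommutativeSemigroup; CommutativeSemiring)
open import Algebra.Core using (Op₂)
import Algebra.Properties.CommutativeSemigroup as Semigroupₚ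
import Algebra.Solver.Ring.NaturalCoefficients.Default as SemiringSolver
open import Algebra.Structures using (IsCommutativeMonoid)
import Algebra.Structures.Biased as Biased
open import Data.Empty using (⊥; ⊥-elim)
open import Data.Fin.Base using (Fin; zero; suc; cast)
open import Data.Fin.Patterns using (0F; 1F; 2F; 3F)
import Data.Integer.Properties as ℤₚ
import Data.Integer.Tactic.RingSolver as ℤ-Solver
open import Data.List.Base
  using ( List; []; _∷_; _++_; length; lookup; map; reverse; filter; foldr; upTo; applyUpTo
        ; cartesianProduct; initLast; _∷ʳ′_)
import Data.List.Membership.DecPropositional as DecMembership
open import Data.List.Membership.Propositional using (_∈_)
open import Data.List.Membership.Propositional.Properties
  using ( ∈-++⁺ˡ; ∈-++⁺ʳ; ∈-++⁻; ∈-∃++; ∈-map⁺; ∈-map⁻; ∈-filter⁺; ∈-filter⁻; ∈-lookup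
        ; ∈-cartesianProduct⁺; ∈-cartesianProduct⁻; ∈-cartesianProductWith⁺; ∈-cartesianProductWith⁻ )
open import Data.List.Properties
  using ( length-++; length-map; length-reverse; length-applyUpTo; map-applyUpTo; ++-identityʳ; ++-assoc; ++-cancelʳ
        ; filter-++; filter-all; filter-none; ∷-injectiveˡ; ∷-injectiveʳ; ∷ʳ-injective
        ; reverse-involutive; reverse-injective )
open import Data.List.Relation.Binary.Permutation.Propositional
  using (_↭_; ↭-refl; ↭-trans; ↭-prep; ↭-sym; ↭-reflexive; ↭⇒↭ₛ)
open import Data.List.Relation.Binary.Permutation.Propositional.Properties
  using (shift; shifts; ↭-length; ∈-resp-↭; drop-∷; drop-mid; filter-↭; ++-comm; ++⁺; ↭-reverse; ↭-empty-inv; ¬x∷xs↭[])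
import Data.List.Relation.Binary.Permutation.Setoid.Properties as Setoid-↭
open import Data.List.Relation.Binary.Sublist.Propositional
  using (_⊆_; []; _∷_; minimum; ⊆-refl; ⊆-trans; from∈) renaming (_∷ʳ_ to _∷ʳˢ_)
import Data.List.Relation.Binary.Sublist.Propositional.Properties as Sublistₚ
open import Data.List.Relation.Unary.All as All using (All; []; _∷_)
import Data.List.Relation.Unary.All.Properties as Allₚ
open import Data.List.Relation.Unary.AllPairs as AllPairs using (AllPairs; []; _∷_)
import Data.List.Relation.Unary.AllPairs.Properties as AllPairsₚ
open import Data.List.Relation.Unary.Any using (here; there)
import Data.Nat.Properties as ℕₚ
open import Data.List.Relation.Unary.Unique.DecSetoid ℕₚ.≡-decSetoid using (unique?)
open import Data.List.Relation.Unary.Unique.Propositional using (Unique)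
import Data.List.Relation.Unary.Unique.Propositional.Properties as Uniqueₚ
open import Data.Nat.Base using (ℕ; zero; suc; _+_; _*_; _∸_; _≤_; _<_; z≤n; s≤s)
import Data.Nat.Tactic.RingSolver as ℕ-Solver
open import Data.Product.Base using (∃; ∃₂; _×_; _,_)
open import Data.Sum.Base as Sum using (_⊎_; inj₁; inj₂)
open import Function.Base using (_∘_; flip)
open import Function.Bundles using (_⇔_; mk⇔; module Equivalence)
open import Level using (0ℓ)
import Relation.Binary.Construct.Flip.EqAndOrd as Flip
open import Relation.Binary.Core using (Rel)
open import Relation.Binary.Definitions using (tri<; tri≈; tri>)
open import Relation.Binary.PropositionalEquality
  using (_≡_; _≢_; refl; sym; trans; cong; cong₂; subst; subst₂; module ≡-Reasoning) renaming (setoid to ≡-setoid)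
import Relation.Binary.Reasoning.Setoid as SetoidReasoning
open import Relation.Binary.Structures using (IsEquivalence; IsStrictTotalOrder)
open import Relation.Nullary using (¬_; yes; no)
open import Relation.Unary using (Pred; Decidable)

open DecMembership ℕₚ._≟_ using (_∈?_)

-- Each class is a predicate on words that rearrange a given sorted alphabet, not on permutations of
-- {1, ..., n}. A piece of a word then belongs to a class over a piece of the alphabet, with no
-- standardisation, and the counts depend on lengths alone. Cutting the alphabet at the first letter
-- of the word gives one term of a sum over i + j = n; the word determines the cut, so the terms are
-- disjoint.
--
-- The obstacle is that the words W live on two alphabets: `countY k m` and `countZ k m` depend on
-- the number k of small letters and the number m of large ones. Summed over k + m = n they obey a
-- recurrence in n, and these sums suffice: every cut of the letters below a into a lower part for W
-- and an upper part P occurs, so once the size of P is fixed, the letters of W run through all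
-- divisions k + m. This is why H counts by total length and enters F as the product C H.

∈-remove : {A : Set} {x z : A} (ys : List A) {zs : List A} →
           z ≢ x → z ∈ ys ++ x ∷ zs → z ∈ ys ++ zs
∈-remove []       z≢x (here z≡x) = ⊥-elim (z≢x z≡x)
∈-remove []       z≢x (there z∈) = z∈
∈-remove (y ∷ ys) z≢x (here z≡y) = here z≡y
∈-remove (y ∷ ys) z≢x (there z∈) = there (∈-remove ys z≢x z∈)

-- Each letter of `xs` is struck out of `ys` once; as `xs` has no repeats, its remaining letters
-- survive the striking. The leftover `zs` yields the comparison of lengths, and equal lengths make
-- it empty.
Unique-⊆⇒↭ : {A : Set} {xs ys : List A} → Unique xs → (∀ {x} → x ∈ xs → x ∈ ys) →
             ∃ λ zs → ys ↭ xs ++ zs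
Unique-⊆⇒↭ {ys = ys} []         sub = ys , ↭-refl
Unique-⊆⇒↭ {xs = x ∷ _} (x∉ ∷ u) sub with ∈-∃++ (sub (here refl))
... | ys₁ , ys₂ , refl
  with zs , ρ ← Unique-⊆⇒↭ u (λ z∈ → ∈-remove ys₁ (All.lookup x∉ z∈ ∘ sym) (sub (there z∈)))
  = zs , ↭-trans (shift x ys₁ ys₂) (↭-prep x ρ)

Unique-⊆⇒length≤ : {A : Set} {xs ys : List A} → Unique xs → (∀ {x} → x ∈ xs → x ∈ ys) →
                   length xs ≤ length ys
Unique-⊆⇒length≤ {xs = xs} u sub with zs , ρ ← Unique-⊆⇒↭ u sub =
  ℕₚ.≤-trans (ℕₚ.m≤m+n (length xs) (length zs))
    (ℕₚ.≤-reflexive (sym (trans (↭-length ρ) (length-++ xs))))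

Unique-⊆-length⇒↭ : {A : Set} {xs ys : List A} → Unique xs → (∀ {x} → x ∈ xs → x ∈ ys) →
                    length xs ≡ length ys → xs ↭ ys
Unique-⊆-length⇒↭ {xs = xs} u sub eq with Unique-⊆⇒↭ u sub
... | []     , ρ = ↭-sym (subst (_ ↭_) (++-identityʳ xs) ρ)
... | z ∷ zs , ρ = ⊥-elim (ℕₚ.m≢1+m+n (length xs)
    (trans (trans eq (trans (↭-length ρ) (length-++ xs))) (ℕₚ.+-suc (length xs) (length zs))))

-- Counting by enumeration

-- Cardinality by an exhaustive list without repeats. Pigeonhole makes any two counts of one
-- predicate agree; the recursive count and the enumeration `S n T` meet in this way.
record Size {A : Set} (P : A → Set) (n : ℕ) : Set where
  field
    elements : List A
    unique   : Unique elements
    sound    : ∀ {w} → w ∈ elements → P w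
    complete : ∀ {w} → P w → w ∈ elements
    count    : length elements ≡ n

open Size

Size-unique : {A : Set} {P : A → Set} {m n : ℕ} → Size P m → Size P n → m ≡ n
Size-unique s t = trans (sym (count s)) (trans
  (ℕₚ.≤-antisym (Unique-⊆⇒length≤ (unique s) (complete t ∘ sound s))
                (Unique-⊆⇒length≤ (unique t) (complete s ∘ sound t)))
  (count t))

module _ {A : Set} {P Q : A → Set} where

  Size-⇔ : ∀ {n} → (∀ {w} → P w → Q w) → (∀ {w} → Q w → P w) → Size P n → Size Q n
  Size-⇔ to from s = record
    { elements = elements s ; unique = unique s
    ; sound = to ∘ sound s ; complete = complete s ∘ from ; count = count s }

  Size-⊎ : ∀ {m n} → (∀ {w} → P w → Q w → ⊥) → Size P m → Size Q n →
           Size (λ w → P w ⊎ Q w) (m + n)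
  Size-⊎ disjoint s t = record
    { elements = elements s ++ elements t
    ; unique   = Uniqueₚ.++⁺ (unique s) (unique t) (λ (v , w) → disjoint (sound s v) (sound t w))
    ; sound    = λ w∈ → Sum.map (sound s) (sound t) (∈-++⁻ (elements s) w∈)
    ; complete = λ { (inj₁ p) → ∈-++⁺ˡ (complete s p)
                   ; (inj₂ q) → ∈-++⁺ʳ (elements s) (complete t q) }
    ; count    = trans (length-++ (elements s)) (cong₂ _+_ (count s) (count t)) }

Size-∅ : {A : Set} {P : A → Set} → (∀ {w} → ¬ P w) → Size P 0
Size-∅ empty = record
  { elements = [] ; unique = [] ; sound = λ () ; complete = λ p → ⊥-elim (empty p) ; count = refl }

Size-singleton : {A : Set} (v : A) → Size (_≡ v) 1
Size-singleton v = record
  { elements = v ∷ [] ; unique = [] ∷ [] ; sound = λ { (here eq) → eq }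
  ; complete = here ; count = refl }

Unique-map : {A B : Set} (f : A → B) {xs : List A} →
             (∀ {u v} → u ∈ xs → v ∈ xs → f u ≡ f v → u ≡ v) → Unique xs → Unique (map f xs)
Unique-map f inj []       = []
Unique-map f inj (x∉ ∷ u) =
  Allₚ.map⁺ (All.tabulate λ z∈ → All.lookup x∉ z∈ ∘ inj (here refl) (there z∈))
  ∷ Unique-map f (λ u∈ v∈ → inj (there u∈) (there v∈)) u

-- Injectivity is asked for on members of `P` alone: concatenation of pairs, for instance, is
-- injective once the length of the first part is prescribed.
Size-map : {A B : Set} {P : A → Set} {n : ℕ} (f : A → B) →
           (∀ {u v} → P u → P v → f u ≡ f v → u ≡ v) →
           Size P n → Size (λ w → ∃ λ u → P u × w ≡ f u) n
Size-map f inj s = record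
  { elements = map f (elements s)
  ; unique   = Unique-map f (λ u∈ v∈ → inj (sound s u∈) (sound s v∈)) (unique s)
  ; sound    = λ w∈ → let u , u∈ , eq = ∈-map⁻ f w∈ in u , sound s u∈ , eq
  ; complete = λ { (u , p , refl) → ∈-map⁺ f (complete s p) }
  ; count    = trans (length-map f (elements s)) (count s) }

length-cartesianProduct : {A B : Set} (xs : List A) (ys : List B) →
                          length (cartesianProduct xs ys) ≡ length xs * length ys
length-cartesianProduct []       ys = refl
length-cartesianProduct (x ∷ xs) ys =
  trans (length-++ (map (x ,_) ys))
    (cong₂ _+_ (length-map (x ,_) ys) (length-cartesianProduct xs ys))

Size-× : {A B : Set} {P : A → Set} {Q : B → Set} {m n : ℕ} → Size P m → Size Q n →
         Size (λ (u , v) → P u × Q v) (m * n)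
Size-× s t = record
  { elements = cartesianProduct (elements s) (elements t)
  ; unique   = Uniqueₚ.cartesianProduct⁺ (unique s) (unique t)
  ; sound    = λ w∈ → let u∈ , v∈ = ∈-cartesianProduct⁻ (elements s) (elements t) w∈
                      in sound s u∈ , sound t v∈
  ; complete = λ (p , q) → ∈-cartesianProduct⁺ (complete s p) (complete t q)
  ; count    = trans (length-cartesianProduct (elements s) (elements t))
                 (cong₂ _*_ (count s) (count t)) }

-- Sums over i + j = n in a commutative monoid

module Convolution {A : Set} {_∙_ : Op₂ A} {ε : A} (isCM : IsCommutativeMonoid _≡_ _∙_ ε) where

  open IsCommutativeMonoid isCM using (assoc; comm; isCommutativeSemigroup)

  commutativeSemigroup : CommutativeSemigroup 0ℓ 0ℓ
  commutativeSemigroup = record { isCommutativeSemigroup = isCommutativeSemigroup }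

  open Semigroupₚ commutativeSemigroup using (interchange)

  -- A general two-place summand covers both Cauchy products and totals of a two-parameter family
  -- such as `countZ`. In the recursion the first argument grows as a cut does when it moves along a
  -- list in `Size-splits`.
  convolve : (ℕ → ℕ → A) → ℕ → A
  convolve g zero    = g 0 0
  convolve g (suc n) = g 0 (suc n) ∙ convolve (g ∘ suc) n

  convolve-cong : ∀ {f g} → (∀ i j → f i j ≡ g i j) → ∀ n → convolve f n ≡ convolve g n
  convolve-cong eq zero    = eq 0 0
  convolve-cong eq (suc n) = cong₂ _∙_ (eq 0 (suc n)) (convolve-cong (eq ∘ suc) n)

  convolve-∙ : ∀ f g n → convolve (λ i j → f i j ∙ g i j) n ≡ convolve f n ∙ convolve g n
  convolve-∙ f g zero    = refl
  convolve-∙ f g (suc n) = trans (cong ((f 0 (suc n) ∙ g 0 (suc n)) ∙_) (convolve-∙ (f ∘ suc) (g ∘ suc) n))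
                                 (interchange (f 0 (suc n)) (g 0 (suc n)) _ _)

  convolve-homo : (φ : A → A) → (∀ x y → φ (x ∙ y) ≡ φ x ∙ φ y) →
                  ∀ g n → convolve (λ i j → φ (g i j)) n ≡ φ (convolve g n)
  convolve-homo φ homo g zero    = refl
  convolve-homo φ homo g (suc n) = trans (cong (φ (g 0 (suc n)) ∙_) (convolve-homo φ homo (g ∘ suc) n))
                                         (sym (homo (g 0 (suc n)) (convolve (g ∘ suc) n)))

  -- The special cases of a split, with nothing or a single letter beyond the cut, sit at the j = 0
  -- end of the sum; this isolates them.
  convolve-last : ∀ g n → convolve g (suc n) ≡ g (suc n) 0 ∙ convolve (λ i j → g i (suc j)) n
  convolve-last g zero    = comm (g 0 1) (g 1 0)
  convolve-last g (suc n) = begin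
    g 0 (2 + n) ∙ convolve (g ∘ suc) (suc n)       ≡⟨ cong (g 0 (2 + n) ∙_) (convolve-last (g ∘ suc) n) ⟩
    g 0 (2 + n) ∙ (g (2 + n) 0 ∙ rest)             ≡⟨ assoc (g 0 (2 + n)) (g (2 + n) 0) rest ⟨
    (g 0 (2 + n) ∙ g (2 + n) 0) ∙ rest             ≡⟨ cong (_∙ rest) (comm (g 0 (2 + n)) (g (2 + n) 0)) ⟩
    (g (2 + n) 0 ∙ g 0 (2 + n)) ∙ rest             ≡⟨ assoc (g (2 + n) 0) (g 0 (2 + n)) rest ⟩
    g (2 + n) 0 ∙ (g 0 (2 + n) ∙ rest)             ∎
    where
    open ≡-Reasoning
    rest = convolve (λ i j → g (suc i) (suc j)) n

  convolve-comm : ∀ g n → convolve g n ≡ convolve (λ i j → g j i) n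
  convolve-comm g zero    = refl
  convolve-comm g (suc n) =
    trans (cong (g 0 (suc n) ∙_) (convolve-comm (g ∘ suc) n))
          (sym (convolve-last (λ i j → g j i) n))

  -- Both sides sum `k a b l` over a + b + l = n. This serves the product of series and the
  -- regrouping of alphabets in `countB-convolve`.
  convolve-assoc : ∀ (k : ℕ → ℕ → ℕ → A) n →
    convolve (λ i l → convolve (λ a b → k a b l) i) n ≡
    convolve (λ a i → convolve (λ b l → k a b l) i) n
  convolve-assoc k zero    = refl
  convolve-assoc k (suc n) = begin
    k 0 0 (suc n) ∙ convolve (λ i l → k 0 (suc i) l ∙ convolve (λ a b → k (suc a) b l) i) n
      ≡⟨ cong (k 0 0 (suc n) ∙_) (convolve-∙ (λ i → k 0 (suc i)) (λ i l → convolve (λ a b → k (suc a) b l) i) n) ⟩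
    k 0 0 (suc n) ∙ (convolve (k 0 ∘ suc) n ∙ convolve (λ i l → convolve (λ a b → k (suc a) b l) i) n)
      ≡⟨ assoc (k 0 0 (suc n)) (convolve (k 0 ∘ suc) n) _ ⟨
    convolve (k 0) (suc n) ∙ convolve (λ i l → convolve (λ a b → k (suc a) b l) i) n
      ≡⟨ cong (convolve (k 0) (suc n) ∙_) (convolve-assoc (k ∘ suc) n) ⟩
    convolve (k 0) (suc n) ∙ convolve (λ a i → convolve (λ b l → k (suc a) b l) i) n ∎
    where open ≡-Reasoning

module Σℕ = Convolution ℕₚ.+-0-isCommutativeMonoid
open Σℕ using (convolve; convolve-last)

-- As `X` is fixed, the length of the left part names the cut; hence disjointness compares lengths
-- alone.
Size-splits : {A B : Set} (Q : List A → List A → B → Set) (g : ℕ → ℕ → ℕ) (X : List A) →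
  (∀ D P → X ≡ D ++ P → Size (Q D P) (g (length D) (length P))) →
  (∀ {D P D′ P′ w} → X ≡ D ++ P → X ≡ D′ ++ P′ → Q D P w → Q D′ P′ w → length D ≡ length D′) →
  Size (λ w → ∃₂ λ D P → X ≡ D ++ P × Q D P w) (convolve g (length X))
Size-splits Q g []      sizes disjoint =
  Size-⇔ (λ q → [] , [] , refl , q) (λ { ([] , [] , refl , q) → q }) (sizes [] [] refl)
Size-splits Q g (x ∷ X) sizes disjoint =
  Size-⇔
    (λ { (inj₁ q) → [] , x ∷ X , refl , q ; (inj₂ (D , P , refl , q)) → x ∷ D , P , refl , q })
    (λ { ([] , _ , refl , q) → inj₁ q ; (_ ∷ D , P , refl , q) → inj₂ (D , P , refl , q) })
    (Size-⊎ (λ { q (D , P , refl , q′) → ℕₚ.0≢1+n (disjoint refl refl q q′) })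
      (sizes [] (x ∷ X) refl)
      (Size-splits (Q ∘ (x ∷_)) (g ∘ suc) X
        (λ D P eq → sizes (x ∷ D) P (cong (x ∷_) eq))
        (λ eq eq′ q q′ → ℕₚ.suc-injective (disjoint (cong (x ∷_) eq) (cong (x ∷_) eq′) q q′))))

Word : Set
Word = List ℕ

-- Sublists and permutations

-- A relational form of ρ ++ τ ≡ σ. Matching on it for an occurrence of three or four letters lists
-- the places where the occurrence can cross the boundary between two factors of a word.
data Cut : Word → Word → Word → Set where
  cut  : ∀ {σ} → Cut σ [] σ
  next : ∀ {x σ ρ τ} → Cut σ ρ τ → Cut (x ∷ σ) (x ∷ ρ) τ

⊆-++⁻ : ∀ {σ} u {v : Word} → σ ⊆ u ++ v → ∃₂ λ ρ τ → Cut σ ρ τ × ρ ⊆ u × τ ⊆ v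
⊆-++⁻ []      s           = _ , _ , cut , [] , s
⊆-++⁻ (x ∷ u) (.x ∷ʳˢ s)  with _ , _ , k , ρ⊆ , τ⊆ ← ⊆-++⁻ u s = _ , _ , k , x ∷ʳˢ ρ⊆ , τ⊆
⊆-++⁻ (x ∷ u) (refl ∷ s)  with _ , _ , k , ρ⊆ , τ⊆ ← ⊆-++⁻ u s = _ , _ , next k , refl ∷ ρ⊆ , τ⊆

infixr 5 _⊆++_

_⊆++_ : ∀ {ρ τ u v : Word} → ρ ⊆ u → τ ⊆ v → ρ ++ τ ⊆ u ++ v
_⊆++_ = Sublistₚ.++⁺

⊆-++ˡ : ∀ u {σ v : Word} → σ ⊆ v → σ ⊆ u ++ v
⊆-++ˡ u = Sublistₚ.++⁺ˡ u

⊆-++ʳ : ∀ v {σ u : Word} → σ ⊆ u → σ ⊆ u ++ v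
⊆-++ʳ v = Sublistₚ.++⁺ʳ v

∈₁ : ∀ {a} {σ w : Word} → a ∷ σ ⊆ w → a ∈ w
∈₁ s = Sublistₚ.Any-resp-⊆ s (here refl)

drop₁ : ∀ {a} {σ w : Word} → a ∷ σ ⊆ w → σ ⊆ w
drop₁ = Sublistₚ.∷ˡ⁻

∈₂ : ∀ {a b} {σ w : Word} → a ∷ b ∷ σ ⊆ w → b ∈ w
∈₂ = ∈₁ ∘ drop₁

∈₃ : ∀ {a b c} {σ w : Word} → a ∷ b ∷ c ∷ σ ⊆ w → c ∈ w
∈₃ = ∈₂ ∘ drop₁

∈-order : ∀ {x y} {w : Word} → x ∈ w → y ∈ w → x ≢ y → x ∷ y ∷ [] ⊆ w ⊎ y ∷ x ∷ [] ⊆ w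
∈-order (here refl) (here refl) x≢y = ⊥-elim (x≢y refl)
∈-order (here refl) (there y∈)  x≢y = inj₁ (refl ∷ from∈ y∈)
∈-order (there x∈)  (here refl) x≢y = inj₂ (refl ∷ from∈ x∈)
∈-order (there x∈)  (there y∈)  x≢y with ∈-order x∈ y∈ x≢y
... | inj₁ s = inj₁ (_ ∷ʳˢ s)
... | inj₂ s = inj₂ (_ ∷ʳˢ s)

module _ {R : Rel ℕ 0ℓ} where

  AllPairs⇒⊆ : ∀ {x y} {w : Word} → AllPairs R w → x ∷ y ∷ [] ⊆ w → R x y
  AllPairs⇒⊆ (_  ∷ rs) (_ ∷ʳˢ s)  = AllPairs⇒⊆ rs s
  AllPairs⇒⊆ (rx ∷ _)  (refl ∷ s) = All.lookup rx (∈₁ s)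

  ⊆⇒AllPairs : ∀ {w} → (∀ {x y} → x ∷ y ∷ [] ⊆ w → R x y) → AllPairs R w
  ⊆⇒AllPairs {[]}    r = []
  ⊆⇒AllPairs {x ∷ w} r = All.tabulate (λ y∈ → r (refl ∷ from∈ y∈)) ∷ ⊆⇒AllPairs (r ∘ (x ∷ʳˢ_))

  AllPairs-⊆ : ∀ {v w} → v ⊆ w → AllPairs R w → AllPairs R v
  AllPairs-⊆ v⊆w rs = ⊆⇒AllPairs (λ s → AllPairs⇒⊆ rs (⊆-trans s v⊆w))

  AllPairs-++⁻ : ∀ {u v x y} → AllPairs R (u ++ v) → x ∈ u → y ∈ v → R x y
  AllPairs-++⁻ rs x∈ y∈ = AllPairs⇒⊆ rs (from∈ x∈ ⊆++ from∈ y∈)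

  AllPairs-↭⇒≡ : (∀ {x y} → R x y → R y x → ⊥) → ∀ {v w} →
                 AllPairs R v → AllPairs R w → v ↭ w → v ≡ w
  AllPairs-↭⇒≡ asym {[]}    {[]}    _ _ _ = refl
  AllPairs-↭⇒≡ asym {[]}    {y ∷ w} _ _ ρ with () ← ∈-resp-↭ (↭-sym ρ) (here refl)
  AllPairs-↭⇒≡ asym {x ∷ v} {[]}    _ _ ρ with () ← ∈-resp-↭ ρ (here refl)
  AllPairs-↭⇒≡ asym {x ∷ v} {y ∷ w} (rx ∷ rv) (ry ∷ rw) ρ
    with ∈-resp-↭ ρ (here refl) | ∈-resp-↭ (↭-sym ρ) (here refl)
  ... | here refl | _         = cong (x ∷_) (AllPairs-↭⇒≡ asym rv rw (drop-∷ ρ))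
  ... | there _   | here refl = cong (x ∷_) (AllPairs-↭⇒≡ asym rv rw (drop-∷ ρ))
  ... | there x∈w | there y∈v = ⊥-elim (asym (All.lookup rx y∈v) (All.lookup ry x∈w))

AllPairs-reverse : ∀ {R : Rel ℕ 0ℓ} {w} → AllPairs R w → AllPairs (flip R) (reverse w)
AllPairs-reverse {w = w} rs = ⊆⇒AllPairs λ {x} {y} s →
  AllPairs⇒⊆ rs (Sublistₚ.reverse⁻ {as = y ∷ x ∷ []} {bs = w} s)

-- Without repeats z occurs once, so both sublists pass through the same position.
⊆-chain : ∀ {y z} {σ w : Word} → Unique w → y ∷ z ∷ [] ⊆ w → z ∷ σ ⊆ w → y ∷ z ∷ σ ⊆ w
⊆-chain (_ ∷ u)  (_ ∷ʳˢ s)  (_ ∷ʳˢ t)  = _ ∷ʳˢ ⊆-chain u s t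
⊆-chain (_ ∷ u)  (refl ∷ s) (_ ∷ʳˢ t)  = refl ∷ t
⊆-chain (x∉ ∷ _) (refl ∷ s) (refl ∷ t) = ⊥-elim (All.lookup x∉ (∈₁ s) refl)
⊆-chain (x∉ ∷ _) (_ ∷ʳˢ s)  (refl ∷ t) = ⊥-elim (All.lookup x∉ (∈₂ s) refl)

Unique-resp-↭ : {A : Set} {v w : List A} → v ↭ w → Unique v → Unique w
Unique-resp-↭ {A} ρ = Setoid-↭.Unique-resp-↭ (≡-setoid A) (↭⇒↭ₛ ρ)

Unique-split : ∀ (u u′ : Word) {b v v′} → Unique (u ++ b ∷ v) → u ++ b ∷ v ≡ u′ ++ b ∷ v′ → u ≡ u′
Unique-split []      []       _ _  = refl
Unique-split []      (_ ∷ u′) (b∉ ∷ _) refl = ⊥-elim (All.lookup b∉ (∈-++⁺ʳ u′ (here refl)) refl)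
Unique-split (_ ∷ u) []       (b∉ ∷ _) refl = ⊥-elim (All.lookup b∉ (∈-++⁺ʳ u (here refl)) refl)
Unique-split (x ∷ u) (y ∷ u′) (_ ∷ un) eq =
  cong₂ _∷_ (∷-injectiveˡ eq) (Unique-split u u′ un (∷-injectiveʳ eq))

++-injective : {A : Set} (u u′ : List A) {v v′ : List A} → length u ≡ length u′ →
               u ++ v ≡ u′ ++ v′ → u ≡ u′ × v ≡ v′
++-injective []      []        _  eq = refl , eq
++-injective (x ∷ u) (x′ ∷ u′) le eq
  with refl ← ∷-injectiveˡ eq | refl , refl ← ++-injective u u′ (ℕₚ.suc-injective le) (∷-injectiveʳ eq) = refl , refl

module _ {P : Pred ℕ 0ℓ} (P? : Decidable P) where

  break : ∀ w → ∃₂ λ u v → w ≡ u ++ v × All P u × (v ≡ [] ⊎ ∃₂ λ y v′ → v ≡ y ∷ v′ × ¬ P y)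
  break []      = [] , [] , refl , [] , inj₁ refl
  break (x ∷ w) with P? x
  ... | no ¬p = [] , x ∷ w , refl , [] , inj₂ (x , w , refl , ¬p)
  ... | yes p with u , v , refl , ps , end ← break w = x ∷ u , v , refl , p ∷ ps , end

  -- After the first letter outside `P` the hypothesis allows no letter of `P`, so the prefix found
  -- by `break` exhausts `P`.
  ⊆-closed⇒++ : ∀ w → (∀ {x y} → x ∷ y ∷ [] ⊆ w → P y → P x) →
                ∃₂ λ u v → w ≡ u ++ v × All P u × All (¬_ ∘ P) v
  ⊆-closed⇒++ w closed with break w
  ... | u , v , refl , ps , inj₁ refl = u , v , refl , ps , []
  ... | u , v , refl , ps , inj₂ (y , v′ , refl , ¬p) =
    u , v , refl , ps , ¬p ∷ All.tabulate (λ z∈ pz → ¬p (closed (⊆-++ˡ u (refl ∷ from∈ z∈)) pz))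

  ↭-partition : ∀ {u v x y} → u ++ v ↭ x ++ y → All P u → All (¬_ ∘ P) v →
                All P x → All (¬_ ∘ P) y → u ↭ x
  ↭-partition {u} {v} {x} {y} ρ pu pv px py =
    ↭-trans (↭-reflexive (sym (filter-++-all u v pu pv)))
      (↭-trans (filter-↭ P? ρ) (↭-reflexive (filter-++-all x y px py)))
    where
    filter-++-all : ∀ u v → All P u → All (¬_ ∘ P) v → filter P? (u ++ v) ≡ u
    filter-++-all u v pu pv =
      trans (filter-++ P? u v)
        (trans (cong₂ _++_ (filter-all P? pu) (filter-none P? pv)) (++-identityʳ u))

++-cancelˡ-↭ : {A : Set} (u : List A) {v w : List A} → u ++ v ↭ u ++ w → v ↭ w
++-cancelˡ-↭ []      ρ = ρ
++-cancelˡ-↭ (x ∷ u) ρ = ++-cancelˡ-↭ u (drop-∷ ρ)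

↭-nonempty : {A : Set} {w : List A} {x : A} {xs : List A} → w ↭ x ∷ xs → w ≢ []
↭-nonempty ρ refl = ¬x∷xs↭[] (↭-sym ρ)

↭-∷ : ∀ {b} {r X : Word} → b ∷ r ↭ X → ∃₂ λ D E → X ≡ D ++ b ∷ E × r ↭ D ++ E
↭-∷ {b} ρ with D , E , refl ← ∈-∃++ (∈-resp-↭ ρ (here refl)) =
  D , E , refl , drop-∷ (↭-trans ρ (shift b D E))

∷-↭ : ∀ {b} {r : Word} (D : Word) {E : Word} → r ↭ D ++ E → b ∷ r ↭ D ++ b ∷ E
∷-↭ {b} D {E} ρ = ↭-trans (↭-prep b ρ) (↭-sym (shift b D E))

-- Fibonacci numbers: `countC (suc n)` is F(2n+1), that is 1, 2, 5, 13, ..., and `sumC n` is F(2n),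
-- that is 0, 1, 3, 8, ....
mutual
  countC : ℕ → ℕ
  countC zero    = 1
  countC (suc n) = countC n + sumC n

  sumC : ℕ → ℕ
  sumC zero    = 0
  sumC (suc n) = sumC n + countC (suc n)

sumC-convolve : ∀ n → convolve (λ i j → countC (suc j)) n ≡ sumC (suc n)
sumC-convolve zero    = refl
sumC-convolve (suc n) = trans (cong (countC (2 + n) +_) (sumC-convolve n)) (ℕₚ.+-comm (countC (2 + n)) (sumC (suc n)))

-- Words avoiding 213 and 3412

module Order {_≺_ : Rel ℕ 0ℓ} (isSTO : IsStrictTotalOrder _≡_ _≺_) where

  open IsStrictTotalOrder isSTO public using (asym; compare; _<?_) renaming (trans to ≺-trans; irrefl to ≺-irrefl)

  Sorted : Word → Set
  Sorted = AllPairs _≺_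

  Sorted⇒Unique : ∀ {w} → Sorted w → Unique w
  Sorted⇒Unique = AllPairs.map (λ { x≺x refl → ≺-irrefl refl x≺x })

  No213 No132 No1324 No3142 No3412 : Word → Set
  No213  w = ∀ {x y z} → x ∷ y ∷ z ∷ [] ⊆ w → y ≺ x → x ≺ z → ⊥
  No132  w = ∀ {x y z} → x ∷ y ∷ z ∷ [] ⊆ w → x ≺ z → z ≺ y → ⊥
  No1324 w = ∀ {x y z t} → x ∷ y ∷ z ∷ t ∷ [] ⊆ w → x ≺ z → z ≺ y → y ≺ t → ⊥
  No3142 w = ∀ {x y z t} → x ∷ y ∷ z ∷ t ∷ [] ⊆ w → y ≺ t → t ≺ x → x ≺ z → ⊥
  No3412 w = ∀ {x y z t} → x ∷ y ∷ z ∷ t ∷ [] ⊆ w → z ≺ t → t ≺ x → x ≺ y → ⊥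

  ⊀⇒≻ : ∀ {x y} → ¬ (x ≺ y) → x ≢ y → y ≺ x
  ⊀⇒≻ {x} {y} x⊀y x≢y with compare x y
  ... | tri< x≺y _ _ = ⊥-elim (x⊀y x≺y)
  ... | tri≈ _ eq _  = ⊥-elim (x≢y eq)
  ... | tri> _ _ y≺x = y≺x

  descending⇒reverse : ∀ {X w} → Sorted X → w ↭ X → (∀ {x y} → x ∷ y ∷ [] ⊆ w → ¬ (x ≺ y)) →
                       w ≡ reverse X
  descending⇒reverse {X} {w} sX ρ desc = AllPairs-↭⇒≡ asym w-desc (AllPairs-reverse sX)
                                   (↭-trans ρ (↭-sym (↭-reverse X)))
    where
    w-desc : AllPairs (flip _≺_) w
    w-unique : Unique w
    w-unique = Unique-resp-↭ (↭-sym ρ) (Sorted⇒Unique sX)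
    w-desc = ⊆⇒AllPairs λ s → ⊀⇒≻ (desc s) (AllPairs⇒⊆ w-unique s)

  Descending : Word → Set
  Descending w = ∀ {x y} → x ∷ y ∷ [] ⊆ w → x ≺ y → ⊥

  reverse-Descending : ∀ {X} → Sorted X → Descending (reverse X)
  reverse-Descending sX s x≺y = asym x≺y (AllPairs⇒⊆ (AllPairs-reverse sX) s)

  No213⇒No3142 : ∀ {w} → No213 w → No3142 w
  No213⇒No3142 av s y≺t t≺x = av (⊆-trans (refl ∷ refl ∷ refl ∷ minimum _) s) (≺-trans y≺t t≺x)

  module _ {b : ℕ} {r : Word} where

    No213-∷ : (∀ {y z} → y ∷ z ∷ [] ⊆ r → y ≺ b → b ≺ z → ⊥) → No213 r → No213 (b ∷ r)
    No213-∷ first av (_ ∷ʳˢ s)  = av s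
    No213-∷ first av (refl ∷ s) = first s

    No3142-∷ : (∀ {y z t} → y ∷ z ∷ t ∷ [] ⊆ r → y ≺ t → t ≺ b → b ≺ z → ⊥) → No3142 r → No3142 (b ∷ r)
    No3142-∷ first av (_ ∷ʳˢ s)  = av s
    No3142-∷ first av (refl ∷ s) = first s

    No3412-∷ : (∀ {y z t} → y ∷ z ∷ t ∷ [] ⊆ r → z ≺ t → t ≺ b → b ≺ y → ⊥) → No3412 r → No3412 (b ∷ r)
    No3412-∷ first av (_ ∷ʳˢ s)  = av s
    No3412-∷ first av (refl ∷ s) = first s

  module _ {u v : Word} (v≺u : ∀ {x y} → x ∈ u → y ∈ v → y ≺ x) (v↘ : Descending v) where

    -- An occurrence reaching into v would need an ascent inside v or a rise from u to v, and
    -- neither exists. The same argument excludes 3412.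
    No213-++ : No213 u → No213 (u ++ v)
    No213-++ av s y≺x x≺z with ⊆-++⁻ u s
    ... | _ , _ , cut                   , _ , s₂ = v↘ (drop₁ s₂) (≺-trans y≺x x≺z)
    ... | _ , _ , next cut              , s₁ , s₂ = asym x≺z (v≺u (∈₁ s₁) (∈₂ s₂))
    ... | _ , _ , next (next cut)       , s₁ , s₂ = asym x≺z (v≺u (∈₁ s₁) (∈₁ s₂))
    ... | _ , _ , next (next (next cut)) , s₁ , _ = av s₁ y≺x x≺z

    No3412-++ : No3412 u → No3412 (u ++ v)
    No3412-++ av s z≺t t≺x x≺y with ⊆-++⁻ u s
    ... | _ , _ , cut                   , _ , s₂ = v↘ (drop₁ (drop₁ s₂)) z≺t
    ... | _ , _ , next cut              , _ , s₂ = v↘ (drop₁ s₂) z≺t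
    ... | _ , _ , next (next cut)       , _ , s₂ = v↘ s₂ z≺t
    ... | _ , _ , next (next (next cut)) , s₁ , s₂ = asym z≺t (v≺u (∈₃ s₁) (∈₁ s₂))
    ... | _ , _ , next (next (next (next cut))) , s₁ , _ = av s₁ z≺t t≺x x≺y

  record C (X w : Word) : Set where
    field
      perm   : w ↭ X
      no213  : No213 w
      no3412 : No3412 w

  -- `D` holds the letters below the first letter b. In the last clause it may be empty, which is
  -- the case of b smallest; an empty second part offers no first letter.
  C-Split : Word → Word → Word → Set
  C-Split D []          w = ⊥
  C-Split D (b ∷ [])    w = ∃ λ r → C D r × w ≡ b ∷ r
  C-Split D (b ∷ x ∷ E) w = ∃ λ u → C (x ∷ E) u × w ≡ b ∷ u ++ reverse D

  Sorted-∷⁺ : ∀ D {b E x} → Sorted (D ++ b ∷ E) → x ∈ E → b ≺ x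
  Sorted-∷⁺ D sX x∈ = AllPairs-++⁻ (AllPairs-⊆ (⊆-++ˡ D ⊆-refl) sX) (here refl) x∈

  C-tail : ∀ {b r X} → No213 (b ∷ r) → No3412 (b ∷ r) → r ↭ X → C X r
  C-tail no213 no3412 ρ = record
    { perm = ρ ; no213 = no213 ∘ (_ ∷ʳˢ_) ; no3412 = no3412 ∘ (_ ∷ʳˢ_) }

  -- The patterns behind the two hypotheses are left open because they differ: in `C` a 213 starting
  -- at b is enough, while in `Y` the lower letters include small ones, for which a 3142 is needed
  -- too.
  skew-decomposition : ∀ D {b x E r} → Sorted (D ++ b ∷ x ∷ E) → r ↭ D ++ x ∷ E →
    (∀ {y z} → y ∷ z ∷ [] ⊆ r → b ≺ z → y ∈ D → ⊥) →
    (∀ {e y z} → e ∷ y ∷ z ∷ [] ⊆ r → b ≺ e → y ≺ z → z ∈ D → ⊥) →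
    ∃ λ u → u ↭ x ∷ E × r ≡ u ++ reverse D
  skew-decomposition D {b} {x} {E} {r} sX ρ closed desc = result (⊆-closed⇒++ (b <?_) r closed′)
    where
    D≺ : ∀ {y z} → y ∈ D → z ∈ b ∷ x ∷ E → y ≺ z
    D≺ = AllPairs-++⁻ sX
    E≻ : ∀ {y} → y ∈ x ∷ E → b ≺ y
    E≻ = Sorted-∷⁺ D sX
    closed′ : ∀ {y z} → y ∷ z ∷ [] ⊆ r → b ≺ z → b ≺ y
    closed′ {y} {z} s b≺z with ∈-++⁻ D (∈-resp-↭ ρ (∈₁ s))
    ... | inj₁ y∈D = ⊥-elim (closed s b≺z y∈D)
    ... | inj₂ y∈E = E≻ y∈E
    result : ∃₂ (λ u v → r ≡ u ++ v × All (b ≺_) u × All (¬_ ∘ (b ≺_)) v) →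
             ∃ λ u → u ↭ x ∷ E × r ≡ u ++ reverse D
    result (u , v , refl , b≺u , b⊀v) =
      u , u↭ , cong (u ++_) (descending⇒reverse (AllPairs-⊆ (⊆-++ʳ _ ⊆-refl) sX) v↭ v↘)
      where
      u↭ : u ↭ x ∷ E
      u↭ = ↭-partition (b <?_) (↭-trans ρ (++-comm D (x ∷ E))) b≺u b⊀v
             (All.tabulate E≻) (All.tabulate λ y∈ b≺y → asym b≺y (D≺ y∈ (here refl)))
      v↭ : v ↭ D
      v↭ = ++-cancelˡ-↭ u (↭-trans ρ (↭-trans (++-comm D (x ∷ E)) (++⁺ (↭-sym u↭) ↭-refl)))
      v↘ : ∀ {y z} → y ∷ z ∷ [] ⊆ v → ¬ (y ≺ z)
      -- The letter x lies above b and in u, so it precedes every ascent of v: together with b it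
      -- plays the 34 of a 3412.
      v↘ s y≺z = desc (from∈ (∈-resp-↭ (↭-sym u↭) (here refl)) ⊆++ s) (E≻ (here refl)) y≺z
                   (∈-resp-↭ v↭ (∈₂ s))

  -- A 213 with b as the 2 forbids a letter below b before a letter above b;
  -- a 3412 with b as the 3 then makes the letters below b descend.
  C⇒reverse : ∀ D {b x E r} → Sorted (D ++ b ∷ x ∷ E) → r ↭ D ++ x ∷ E →
              No213 (b ∷ r) → No3412 (b ∷ r) → ∃ λ u → C (x ∷ E) u × r ≡ u ++ reverse D
  C⇒reverse D {b} {x} {E} {r} sX ρ no213 no3412
    with u , u↭ , refl ← skew-decomposition D sX ρ
      (λ s b≺z y∈D → no213 (refl ∷ s) (AllPairs-++⁻ sX y∈D (here refl)) b≺z)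
      (λ s b≺e y≺z z∈D → no3412 (refl ∷ s) y≺z (AllPairs-++⁻ sX z∈D (here refl)) b≺e)
    = u , C-tail (no213 ∘ ⊆-++ʳ _) (no3412 ∘ ⊆-++ʳ _) u↭ , refl

  C⇒Split : ∀ {X w} → Sorted X → w ≢ [] → C X w → ∃₂ λ D Y → X ≡ D ++ Y × C-Split D Y w
  C⇒Split {w = []}    sX w≢[] cw = ⊥-elim (w≢[] refl)
  C⇒Split {w = b ∷ r} sX _ cw with ↭-∷ (C.perm cw)
  ... | D , [] , refl , ρ = D , b ∷ [] , refl , r ,
    C-tail (C.no213 cw) (C.no3412 cw) (subst (r ↭_) (++-identityʳ D) ρ) , refl
  ... | D , x ∷ E , refl , ρ with u , cu , refl ← C⇒reverse D sX ρ (C.no213 cw) (C.no3412 cw)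
    = D , b ∷ x ∷ E , refl , u , cu , refl

  C-skew : ∀ D {b Y u} → Sorted (D ++ b ∷ Y) → C Y u → C (D ++ b ∷ Y) (b ∷ u ++ reverse D)
  C-skew D {b} {Y} {u} sX cu = record
    { perm   = ∷-↭ D (↭-trans (++-comm u (reverse D)) (++⁺ (↭-reverse D) perm))
    ; no213  = No213-++ below (reverse-Descending sD)
                 (No213-∷ (λ s y≺b _ → asym y≺b (b≺u (∈₁ s))) no213)
    ; no3412 = No3412-++ below (reverse-Descending sD)
                 (No3412-∷ (λ s _ t≺b _ → asym t≺b (b≺u (∈₃ s))) no3412) }
    where
    open C cu
    sD : Sorted D
    sD = AllPairs-⊆ (⊆-++ʳ _ ⊆-refl) sX
    b≺u : ∀ {y} → y ∈ u → b ≺ y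
    b≺u y∈ = Sorted-∷⁺ D sX (∈-resp-↭ perm y∈)
    below : ∀ {x y} → x ∈ b ∷ u → y ∈ reverse D → y ≺ x
    below x∈ y∈ = AllPairs-++⁻ sX (∈-resp-↭ (↭-reverse D) y∈) (∈-resp-↭ (↭-prep b perm) x∈)

  C-top : ∀ D {b r} → Sorted (D ++ b ∷ []) → C D r → C (D ++ b ∷ []) (b ∷ r)
  C-top D {b} {r} sX cr = record
    { perm   = ∷-↭ D (subst (r ↭_) (sym (++-identityʳ D)) perm)
    ; no213  = No213-∷ (λ s _ b≺z → asym b≺z (≺b (∈₂ s))) no213
    ; no3412 = No3412-∷ (λ s _ _ b≺y → asym b≺y (≺b (∈₁ s))) no3412 }
    where
    open C cr
    ≺b : ∀ {y} → y ∈ r → y ≺ b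
    ≺b y∈ = AllPairs-++⁻ sX (∈-resp-↭ perm y∈) (here refl)

  Split⇒C : ∀ {X} D Y {w} → Sorted X → X ≡ D ++ Y → C-Split D Y w → C X w
  Split⇒C D (b ∷ [])    sX refl (r , cr , refl) = C-top D sX cr
  Split⇒C D (b ∷ x ∷ E) sX refl (u , cu , refl) = C-skew D sX cu

  -- The word starts with the first letter of the right part, and that letter occurs once in `X`.
  split-at-head : (Q : Word → Word → Word → Set) →
    (∀ D Y {w} → Q D Y w → ∃₂ λ b E → Y ≡ b ∷ E × ∃ λ r → w ≡ b ∷ r) →
    ∀ {X} → Unique X → ∀ {D Y D′ Y′ w} →
    X ≡ D ++ Y → X ≡ D′ ++ Y′ → Q D Y w → Q D′ Y′ w → length D ≡ length D′
  split-at-head Q head uX {D} {Y} {D′} {Y′} eq eq′ q q′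
    with head D Y q | head D′ Y′ q′
  ... | _ , _ , refl , _ , refl | _ , _ , refl , _ , refl =
    cong length (Unique-split D D′ (subst Unique eq uX) (trans (sym eq) eq′))

  C-Split-head : ∀ D Y {w} → C-Split D Y w → ∃₂ λ b E → Y ≡ b ∷ E × ∃ λ r → w ≡ b ∷ r
  C-Split-head D (b ∷ [])    (_ , _ , eq) = _ , _ , refl , _ , eq
  C-Split-head D (b ∷ x ∷ E) (_ , _ , eq) = _ , _ , refl , _ , eq

  countC-split : ℕ → ℕ → ℕ
  countC-split i zero          = 0
  countC-split i (suc zero)    = countC i
  countC-split i (suc (suc j)) = countC (suc j)

  countC-split-convolve : ∀ n → convolve countC-split (suc n) ≡ countC (suc n)
  countC-split-convolve n = trans (convolve-last countC-split n) (step n)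
    where
    step : ∀ n → convolve (λ i j → countC-split i (suc j)) n ≡ countC (suc n)
    step zero    = refl
    step (suc n) = trans (convolve-last (λ i j → countC-split i (suc j)) n)
                         (cong (countC (suc n) +_) (sumC-convolve n))

  -- The recursion runs on the pieces `D` and `x ∷ E` of the alphabet, which are shorter than `X`
  -- but not subterms of it; `N` bounds their lengths.
  Size-C : ∀ {N} X → length X ≤ N → Sorted X → Size (C X) (countC (length X))
  Size-C []      _ _ = Size-⇔
    (λ { refl → record { perm = ↭-refl ; no213 = λ () ; no3412 = λ () } })
    (λ cw → ↭-empty-inv (C.perm cw)) (Size-singleton [])
  Size-C {suc N} X@(x₀ ∷ X₀) (s≤s len) sX = Size-⇔
    (λ (D , Y , eq , q) → Split⇒C D Y sX eq q)
    (λ cw → C⇒Split sX (↭-nonempty (C.perm cw)) cw)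
    (subst (Size _) (countC-split-convolve (length X₀))
      (Size-splits C-Split countC-split X sizes (split-at-head C-Split C-Split-head (Sorted⇒Unique sX))))
    where
    bound : ∀ D {b Y} → X ≡ D ++ b ∷ Y → length D + length Y ≤ N
    bound D {b} {Y} eq = ℕₚ.≤-trans (ℕₚ.≤-reflexive (ℕₚ.suc-injective (sym
      (trans (cong length eq) (trans (length-++ D) (ℕₚ.+-suc (length D) (length Y))))))) len
    sizes : ∀ D Y → X ≡ D ++ Y → Size (C-Split D Y) (countC-split (length D) (length Y))
    sizes D []          eq = Size-∅ λ ()
    sizes D (b ∷ [])    eq = Size-map (b ∷_) (λ _ _ → ∷-injectiveʳ)
      (Size-C D (ℕₚ.≤-trans (ℕₚ.m≤m+n _ _) (bound D eq)) (AllPairs-⊆ (⊆-++ʳ _ ⊆-refl) (subst Sorted eq sX)))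
    sizes D (b ∷ x ∷ E) eq = Size-map (λ u → b ∷ u ++ reverse D)
      (λ _ _ e → ++-cancelʳ _ _ _ (∷-injectiveʳ e))
      (Size-C (x ∷ E) (ℕₚ.≤-trans (ℕₚ.m≤n+m _ (length D)) (bound D eq))
        (AllPairs.tail (AllPairs-⊆ (⊆-++ˡ D ⊆-refl) (subst Sorted eq sX))))

open Order ℕₚ.<-isStrictTotalOrder
  hiding (compare) renaming (≺-trans to <-trans; ≺-irrefl to <-irrefl)

-- Shuffles of descending small letters with large letters

mutual
  countY : ℕ → ℕ → ℕ
  countY zero    zero    = 1
  countY zero    (suc m) = countZ zero (suc m)
  countY (suc k) m       = countY k m + countZ (suc k) m

  -- The first letter is the largest, the smallest, or strictly between. In the last case all
  -- smaller letters descend at the end, and the letters above it, 1 to m in number, contribute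
  -- `sumC m`. A single large letter is both largest and smallest, so its own clause counts it once.
  countZ : ℕ → ℕ → ℕ
  countZ k zero          = 0
  countZ k (suc zero)    = countY k 0
  countZ k (suc (suc m)) = countY k (suc m) + (countY k (suc m) + sumC m)

-- Words shuffling the descending small letters D (below t) into a word on the
-- large letters L (above t); Z asks in addition for a large first letter.
record Y (t : ℕ) (D L w : Word) : Set where
  field
    perm   : w ↭ D ++ L
    small↘ : ∀ {x y} → x ∷ y ∷ [] ⊆ w → x < y → y < t → ⊥
    no213  : ∀ {x y z} → x ∷ y ∷ z ∷ [] ⊆ w → t < y → y < x → x < z → ⊥
    no3412 : No3412 w
    no3142 : No3142 w

-- In the last clause the small letters `D` and the large letters below b end the word in one common
-- descent. With b largest or smallest nothing is forced, and a shorter `Y`-word remains.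
Z-Split : ℕ → Word → Word → Word → Word → Set
Z-Split t D L        []          w = ⊥
Z-Split t D L        (b ∷ [])    w = ∃ λ r → Y t D L r × w ≡ b ∷ r
Z-Split t D []       (b ∷ x ∷ E) w = ∃ λ r → Y t D (x ∷ E) r × w ≡ b ∷ r
Z-Split t D (l ∷ L)  (b ∷ x ∷ E) w = ∃ λ u → C (x ∷ E) u × w ≡ b ∷ u ++ reverse (D ++ l ∷ L)

Z : ℕ → Word → Word → Word → Set
Z t D L w = ∃₂ λ L₁ L₂ → L ≡ L₁ ++ L₂ × Z-Split t D L₁ L₂ w

module _ {t : ℕ} {D L : Word} (sX : Sorted (D ++ t ∷ L)) where

  small : ∀ {x} → x ∈ D → x < t
  small x∈ = AllPairs-++⁻ sX x∈ (here refl)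

  large : ∀ {x} → x ∈ L → t < x
  large = Sorted-∷⁺ D sX

  pair : Sorted (D ++ L)
  pair = AllPairs-⊆ (⊆-refl ⊆++ (t ∷ʳˢ ⊆-refl)) sX

Y-tail : ∀ {t D L D′ L′ b r} → Y t D L (b ∷ r) → r ↭ D′ ++ L′ → Y t D′ L′ r
Y-tail yw ρ = record
  { perm = ρ ; small↘ = small↘ ∘ (_ ∷ʳˢ_) ; no213 = no213 ∘ (_ ∷ʳˢ_)
  ; no3412 = no3412 ∘ (_ ∷ʳˢ_) ; no3142 = no3142 ∘ (_ ∷ʳˢ_) }
  where open Y yw

Y-small : ∀ {t} D {d L r} → Sorted ((D ++ d ∷ []) ++ t ∷ L) → Y t D L r → Y t (D ++ d ∷ []) L (d ∷ r)
Y-small {t} D {d} {L} {r} sX yr = record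
  { perm   = subst (d ∷ r ↭_) (sym (++-assoc D (d ∷ []) L)) (∷-↭ D perm)
  ; small↘ = λ { (_ ∷ʳˢ s) → small↘ s ; (refl ∷ s) d<y y<t → asym d<y (y<d (∈₁ s) y<t) }
  ; no213  = λ { (_ ∷ʳˢ s) → no213 s ; (refl ∷ s) t<y y<d _ → asym (<-trans t<y y<d) d<t }
  ; no3412 = No3412-∷ (λ s z<t t<d _ → small↘ (drop₁ s) z<t (<-trans t<d d<t)) no3412
  ; no3142 = No3142-∷ (λ s y<t t<d _ → small↘ (⊆-trans (refl ∷ _ ∷ʳˢ ⊆-refl) s) y<t (<-trans t<d d<t)) no3142 }
  where
  open Y yr
  d<t : d < t
  d<t = small sX (∈-++⁺ʳ D (here refl))
  y<d : ∀ {y} → y ∈ r → y < t → y < d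
  y<d {y} y∈ y<t with ∈-++⁻ D (∈-resp-↭ perm y∈)
  ... | inj₁ y∈D = AllPairs-++⁻ (AllPairs-⊆ (⊆-++ʳ _ ⊆-refl) sX) y∈D (here refl)
  ... | inj₂ y∈L = ⊥-elim (asym y<t (large sX y∈L))

Y-top : ∀ {t} D L {b r} → Sorted (D ++ t ∷ L ++ b ∷ []) → Y t D L r → Y t D (L ++ b ∷ []) (b ∷ r)
Y-top {t} D L {b} {r} sX yr = record
  { perm   = subst (b ∷ r ↭_) (++-assoc D L (b ∷ [])) (∷-↭ (D ++ L) (subst (r ↭_) (sym (++-identityʳ (D ++ L))) perm))
  ; small↘ = λ { (_ ∷ʳˢ s) → small↘ s ; (refl ∷ s) b<y _ → asym b<y (<b (∈₁ s)) }
  ; no213  = λ { (_ ∷ʳˢ s) → no213 s ; (refl ∷ s) _ _ b<z → asym b<z (<b (∈₂ s)) }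
  ; no3412 = No3412-∷ (λ s _ _ b<y → asym b<y (<b (∈₁ s))) no3412
  ; no3142 = No3142-∷ (λ s _ _ b<z → asym b<z (<b (∈₂ s))) no3142 }
  where
  open Y yr
  <b : ∀ {y} → y ∈ r → y < b
  <b y∈ = AllPairs-++⁻ (subst Sorted (sym (++-assoc D L (b ∷ []))) (pair sX)) (∈-resp-↭ perm y∈) (here refl)

-- The letters of r below b are small and so descend, whereas b as the 3 of a 3142 or 3412 needs an
-- ascent below b. As the 2 of a 213 it would need a large letter below it.
Y-bottom : ∀ {t} D {b L r} → Sorted (D ++ t ∷ b ∷ L) → Y t D L r → Y t D (b ∷ L) (b ∷ r)
Y-bottom {t} D {b} {L} {r} sX yr = record
  { perm   = ∷-↭ D perm
  ; small↘ = λ { (_ ∷ʳˢ s) → small↘ s ; (refl ∷ s) b<y y<t → asym (<-trans b<y y<t) t<b }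
  ; no213  = λ { (_ ∷ʳˢ s) → no213 s ; (refl ∷ s) t<y y<b _ → asym t<y (<b⇒<t (∈₁ s) y<b) }
  ; no3412 = No3412-∷ (λ s z<t t<b _ → small↘ (drop₁ s) z<t (<b⇒<t (∈₃ s) t<b)) no3412
  ; no3142 = No3142-∷ (λ s y<t t<b _ → small↘ (⊆-trans (refl ∷ _ ∷ʳˢ ⊆-refl) s) y<t (<b⇒<t (∈₃ s) t<b)) no3142 }
  where
  open Y yr
  t<b : t < b
  t<b = large sX (here refl)
  <b⇒<t : ∀ {y} → y ∈ r → y < b → y < t
  <b⇒<t y∈ y<b with ∈-++⁻ D (∈-resp-↭ perm y∈)
  ... | inj₁ y∈D = small sX y∈D
  ... | inj₂ y∈L = ⊥-elim (asym y<b (Sorted-∷⁺ D (pair sX) y∈L))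

-- Small letters and large letters below b behave alike here, so the word is a `C`-word on the whole
-- alphabet; its avoidance of 213 excludes 3142 as well.
Y-skew : ∀ {t} D L {b E u} → Sorted (D ++ t ∷ L ++ b ∷ E) → C E u →
         Y t D (L ++ b ∷ E) (b ∷ u ++ reverse (D ++ L))
Y-skew {t} D L {b} {E} {u} sX cu = record
  { perm   = subst (_ ↭_) (++-assoc D L (b ∷ E)) (C.perm cw)
  ; small↘ = small↘
  ; no213  = λ s _ → C.no213 cw s
  ; no3412 = C.no3412 cw
  ; no3142 = No213⇒No3142 (C.no213 cw) }
  where
  sDL : Sorted ((D ++ L) ++ b ∷ E)
  sDL = subst Sorted (sym (++-assoc D L (b ∷ E))) (pair sX)
  cw : C ((D ++ L) ++ b ∷ E) (b ∷ u ++ reverse (D ++ L))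
  cw = C-skew (D ++ L) sDL cu
  bu∈ : ∀ {x} → x ∈ b ∷ u → x ∈ b ∷ E
  bu∈ = ∈-resp-↭ (↭-prep b (C.perm cu))
  small↘ : ∀ {x y} → x ∷ y ∷ [] ⊆ (b ∷ u) ++ reverse (D ++ L) → x < y → y < t → ⊥
  small↘ s x<y y<t with ⊆-++⁻ (b ∷ u) s
  ... | _ , _ , cut , _ , s₂ = reverse-Descending {D ++ L} (AllPairs-⊆ (⊆-++ʳ _ ⊆-refl) sDL) s₂ x<y
  ... | _ , _ , next cut , s₁ , s₂ =
    asym x<y (AllPairs-++⁻ sDL (∈-resp-↭ (↭-reverse (D ++ L)) (∈₁ s₂)) (bu∈ (∈₁ s₁)))
  ... | _ , _ , next (next cut) , s₁ , _ = asym y<t (large sX (∈-++⁺ʳ L (bu∈ (∈₂ s₁))))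

Z⇒Y : ∀ {t D L w} → Sorted (D ++ t ∷ L) → Z t D L w → Y t D L w
Z⇒Y {D = D} sX (L , b ∷ [] , refl , _ , yr , refl)       = Y-top D L sX yr
Z⇒Y {D = D} sX ([] , b ∷ x ∷ E , refl , _ , yr , refl)   = Y-bottom D sX yr
Z⇒Y {D = D} sX (l ∷ L , b ∷ x ∷ E , refl , _ , cu , refl) = Y-skew D (l ∷ L) sX cu

-- Let l be a letter with t < l < b.  A small letter before a letter z above b
-- makes b with them and l a 3142, or b, l and z a 213.
Y⇒reverse : ∀ {t} D l L {b x E r} → Sorted (D ++ t ∷ l ∷ L ++ b ∷ x ∷ E) →
            r ↭ (D ++ l ∷ L) ++ x ∷ E → Y t D (l ∷ L ++ b ∷ x ∷ E) (b ∷ r) →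
            ∃ λ u → C (x ∷ E) u × r ≡ u ++ reverse (D ++ l ∷ L)
Y⇒reverse {t} D l L {b} {x} {E} {r} sX ρ yw
  = result (skew-decomposition (D ++ l ∷ L) sDL ρ closed desc)
  where
  open Y yw
  result : ∃ (λ u → u ↭ x ∷ E × r ≡ u ++ reverse (D ++ l ∷ L)) →
           ∃ λ u → C (x ∷ E) u × r ≡ u ++ reverse (D ++ l ∷ L)
  result (u , u↭ , refl) = u , record
    { perm   = u↭
    ; no213  = λ s → no213 (b ∷ʳˢ ⊆-++ʳ _ s) (large sX (∈-++⁺ʳ (l ∷ L) (there (∈-resp-↭ u↭ (∈₂ s)))))
    ; no3412 = no3412 ∘ (b ∷ʳˢ_) ∘ ⊆-++ʳ _ } , refl
  sDL : Sorted ((D ++ l ∷ L) ++ b ∷ x ∷ E)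
  sDL = subst Sorted (sym (++-assoc D (l ∷ L) (b ∷ x ∷ E))) (pair sX)
  <b : ∀ {z} → z ∈ D ++ l ∷ L → z < b
  <b z∈ = AllPairs-++⁻ sDL z∈ (here refl)
  t<l : ∀ {z} → z ∈ l ∷ L → t < z
  t<l = large sX ∘ ∈-++⁺ˡ
  r-unique : Unique r
  r-unique = AllPairs.tail (Unique-resp-↭ (↭-sym perm) (Sorted⇒Unique (pair sX)))
  l∈r : l ∈ r
  l∈r = ∈-resp-↭ (↭-sym ρ) (∈-++⁺ˡ (∈-++⁺ʳ D (here refl)))
  l<b : l < b
  l<b = <b (∈-++⁺ʳ D (here refl))
  closed : ∀ {y z} → y ∷ z ∷ [] ⊆ r → b < z → y ∈ D ++ l ∷ L → ⊥
  closed {y} {z} s b<z y∈ with ∈-++⁻ D y∈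
  ... | inj₂ y∈L = no213 (refl ∷ s) (t<l y∈L) (<b y∈) b<z
  ... | inj₁ y∈D with ∈-order l∈r (∈₂ s) (λ { refl → asym b<z l<b })
  ...   | inj₁ lz = no213 (refl ∷ lz) (t<l (here refl)) l<b b<z
  ...   | inj₂ zl = no3142 (refl ∷ ⊆-chain r-unique s zl) (<-trans (small sX y∈D) (t<l (here refl))) l<b b<z
  desc : ∀ {e y z} → e ∷ y ∷ z ∷ [] ⊆ r → b < e → y < z → z ∈ D ++ l ∷ L → ⊥
  desc s b<e y<z z∈ = no3412 (refl ∷ s) y<z (<b z∈) b<e

Y-Small : ℕ → Word → Word → Word → Set
Y-Small t D L w = ∃₂ λ D′ d → D ≡ D′ ++ d ∷ [] × ∃ λ r → Y t D′ L r × w ≡ d ∷ r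

Y⇒Small⊎Z : ∀ {t D L b r} → Sorted (D ++ t ∷ L) → Y t D L (b ∷ r) → Y-Small t D L (b ∷ r) ⊎ Z t D L (b ∷ r)
Y⇒Small⊎Z {t} {D} {L} {b} {r} sX yw with ∈-++⁻ D (∈-resp-↭ (Y.perm yw) (here refl))
... | inj₁ b∈D with ∈-∃++ b∈D
...   | D₁ , [] , refl = inj₁ (D₁ , b , refl , r , Y-tail yw
        (drop-mid [] D₁ (subst (b ∷ r ↭_) (++-assoc D₁ (b ∷ []) L) (Y.perm yw))) , refl)
-- A small letter d above b is still to come, and b d would be an ascent to a small letter.
...   | D₁ , d ∷ D₂ , refl = ⊥-elim (Y.small↘ yw (refl ∷ from∈ d∈r) b<d (small sX d∈D))
  where
  d∈D : d ∈ D₁ ++ b ∷ d ∷ D₂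
  d∈D = ∈-++⁺ʳ D₁ (there (here refl))
  b<d : b < d
  b<d = Sorted-∷⁺ D₁ (AllPairs-⊆ (⊆-++ʳ _ ⊆-refl) sX) (here refl)
  d∈r : d ∈ r
  d∈r with ∈-resp-↭ (↭-sym (Y.perm yw)) (∈-++⁺ˡ d∈D)
  ... | here refl = ⊥-elim (<-irrefl refl b<d)
  ... | there d∈r = d∈r
Y⇒Small⊎Z {t} {D} {L} {b} {r} sX yw | inj₂ b∈L with ∈-∃++ b∈L
... | L₁ , L₂ , refl = inj₂ (L₁ , b ∷ L₂ , refl , split L₁ L₂ sX yw ρ)
  where
  ρ : r ↭ (D ++ L₁) ++ L₂
  ρ = drop-mid [] (D ++ L₁) (subst (b ∷ r ↭_) (sym (++-assoc D L₁ (b ∷ L₂))) (Y.perm yw))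
  split : ∀ L₁ L₂ → Sorted (D ++ t ∷ L₁ ++ b ∷ L₂) → Y t D (L₁ ++ b ∷ L₂) (b ∷ r) →
          r ↭ (D ++ L₁) ++ L₂ → Z-Split t D L₁ (b ∷ L₂) (b ∷ r)
  split L₁       []      sX yw ρ = r , Y-tail yw (subst (r ↭_) (++-identityʳ (D ++ L₁)) ρ) , refl
  split []       (x ∷ E) sX yw ρ = r , Y-tail yw (subst (λ D → r ↭ D ++ x ∷ E) (++-identityʳ D) ρ) , refl
  split (l ∷ L₁) (x ∷ E) sX yw ρ with u , cu , refl ← Y⇒reverse D l L₁ sX ρ yw = u , cu , refl

Z-head : ∀ {t D} L₁ L₂ {w} → Z-Split t D L₁ L₂ w → ∃₂ λ b E → L₂ ≡ b ∷ E × ∃ λ r → w ≡ b ∷ r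
Z-head L₁       (b ∷ [])    (_ , _ , eq) = _ , _ , refl , _ , eq
Z-head []       (b ∷ x ∷ E) (_ , _ , eq) = _ , _ , refl , _ , eq
Z-head (l ∷ L₁) (b ∷ x ∷ E) (_ , _ , eq) = _ , _ , refl , _ , eq

countZ-split : ℕ → ℕ → ℕ → ℕ
countZ-split k i       zero          = 0
countZ-split k i       (suc zero)    = countY k i
countZ-split k zero    (suc (suc j)) = countY k (suc j)
countZ-split k (suc i) (suc (suc j)) = countC (suc j)

countZ-split-convolve : ∀ k n → convolve (countZ-split k) (suc n) ≡ countZ k (suc n)
countZ-split-convolve k n = trans (convolve-last (countZ-split k) n) (step n)
  where
  step : ∀ n → convolve (λ i j → countZ-split k i (suc j)) n ≡ countZ k (suc n)
  step zero    = refl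
  step (suc n) = cong (countY k (suc n) +_) (interior n)
    where
    interior : ∀ n → convolve (λ i j → countZ-split k (suc i) (suc j)) n ≡ countY k (suc n) + sumC n
    interior zero    = sym (ℕₚ.+-identityʳ (countY k 1))
    interior (suc n) = trans (convolve-last (λ i j → countZ-split k (suc i) (suc j)) n)
                             (cong (countY k (2 + n) +_) (sumC-convolve n))

length-++-∷ : (u : Word) {b : ℕ} {v : Word} → length (u ++ b ∷ v) ≡ suc (length u + length v)
length-++-∷ u {b} {v} = trans (length-++ u) (ℕₚ.+-suc (length u) (length v))

mutual
  Size-Y : ∀ N {t} D L → length D + length L ≤ N → Sorted (D ++ t ∷ L) →
           Size (Y t D L) (countY (length D) (length L))
  Size-Y N D L le sX with initLast D
  Size-Y N {t} .[] [] le sX | [] = Size-⇔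
    (λ { refl → record { perm = ↭-refl ; small↘ = λ () ; no213 = λ () ; no3412 = λ () ; no3142 = λ () } })
    (λ yw → ↭-empty-inv (Y.perm yw)) (Size-singleton [])
  Size-Y N {t} .[] (l ∷ L) le sX | [] = Size-⇔ (Z⇒Y sX) from (Size-Z N [] (l ∷ L) le sX)
    where
    from : ∀ {w} → Y t [] (l ∷ L) w → Z t [] (l ∷ L) w
    from {[]}    yw = ⊥-elim (↭-nonempty (Y.perm yw) refl)
    from {b ∷ r} yw with Y⇒Small⊎Z sX yw
    ... | inj₂ zw = zw
    ... | inj₁ ([] , _ , () , _)
    ... | inj₁ (_ ∷ _ , _ , () , _)
  Size-Y N {t} .(D ++ d ∷ []) L le sX | D ∷ʳ′ d =
    subst (λ k → Size (Y t (D ++ d ∷ []) L) (countY k (length L))) (sym |D|)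
      (Size-⇔ to from (Size-⊎ disjoint
        (Size-map (d ∷_) (λ _ _ → ∷-injectiveʳ)
          (Size-Y′ N D L (subst (λ k → k + length L ≤ N) |D| le)
            (AllPairs-⊆ (⊆-++ʳ (d ∷ []) (⊆-refl {x = D}) ⊆++ ⊆-refl {x = t ∷ L}) sX)))
        (subst (λ k → Size (Z t (D ++ d ∷ []) L) (countZ k (length L))) |D| (Size-Z N (D ++ d ∷ []) L le sX))))
    where
    |D| : length (D ++ d ∷ []) ≡ suc (length D)
    |D| = trans (length-++-∷ D) (cong suc (ℕₚ.+-identityʳ (length D)))
    to : ∀ {w} → (∃ λ r → Y t D L r × w ≡ d ∷ r) ⊎ Z t (D ++ d ∷ []) L w → Y t (D ++ d ∷ []) L w
    to (inj₁ (r , yr , refl)) = Y-small D sX yr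
    to (inj₂ zw)              = Z⇒Y sX zw
    from : ∀ {w} → Y t (D ++ d ∷ []) L w → (∃ λ r → Y t D L r × w ≡ d ∷ r) ⊎ Z t (D ++ d ∷ []) L w
    from {[]}    yw = ⊥-elim (↭-nonempty (↭-trans (Y.perm yw)
      (subst (_↭ d ∷ D ++ L) (sym (++-assoc D (d ∷ []) L)) (shift d D L))) refl)
    from {b ∷ r} yw with Y⇒Small⊎Z sX yw
    ... | inj₂ zw = inj₂ zw
    ... | inj₁ (D′ , d′ , eq , r′ , yr , eq′) with refl , refl ← ∷ʳ-injective D D′ eq = inj₁ (r′ , yr , eq′)
    disjoint : ∀ {w} → (∃ λ r → Y t D L r × w ≡ d ∷ r) → Z t (D ++ d ∷ []) L w → ⊥
    disjoint (_ , _ , refl) (L₁ , L₂ , refl , q) with Z-head L₁ L₂ q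
    ... | .d , E , refl , _ , refl =
      asym (large sX (∈-++⁺ʳ L₁ (here refl))) (small sX (∈-++⁺ʳ D (here refl)))

  -- Passing from `Y` to `Z` removes no letter, so the bound `N` is lowered here, at the calls that
  -- do remove one.
  Size-Y′ : ∀ N {t} D L → suc (length D + length L) ≤ N → Sorted (D ++ t ∷ L) →
            Size (Y t D L) (countY (length D) (length L))
  Size-Y′ (suc N) D L (s≤s le) = Size-Y N D L le

  Size-Z : ∀ N {t} D L → length D + length L ≤ N → Sorted (D ++ t ∷ L) →
           Size (Z t D L) (countZ (length D) (length L))
  Size-Z N D [] le sX = Size-∅ λ { ([] , [] , refl , ()) }
  Size-Z N {t} D L@(l₀ ∷ L₀) le sX =
    subst (Size _) (countZ-split-convolve (length D) (length L₀))
      (Size-splits (Z-Split t D) (countZ-split (length D)) L sizes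
        (split-at-head (Z-Split t D) Z-head
          (Sorted⇒Unique (AllPairs-⊆ (⊆-++ˡ D (t ∷ʳˢ ⊆-refl)) sX))))
    where
    bound : ∀ L₁ {b L₂} → L ≡ L₁ ++ b ∷ L₂ → suc (length D + (length L₁ + length L₂)) ≤ N
    bound L₁ eq = subst (_≤ N) (trans (cong (length D +_) (trans (cong length eq) (length-++-∷ L₁)))
      (ℕₚ.+-suc (length D) _)) le
    sizes : ∀ L₁ L₂ → L ≡ L₁ ++ L₂ → Size (Z-Split t D L₁ L₂) (countZ-split (length D) (length L₁) (length L₂))
    sizes L₁       []          eq = Size-∅ λ ()
    sizes L₁       (b ∷ [])    eq = Size-map (b ∷_) (λ _ _ → ∷-injectiveʳ)
      (Size-Y′ N D L₁ (subst (λ m → suc (length D + m) ≤ N) (ℕₚ.+-identityʳ _) (bound L₁ eq))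
        (AllPairs-⊆ (⊆-refl {x = D} ⊆++ (refl ∷ ⊆-++ʳ _ ⊆-refl)) (subst (λ L → Sorted (D ++ t ∷ L)) eq sX)))
    sizes []       (b ∷ x ∷ E) eq = Size-map (b ∷_) (λ _ _ → ∷-injectiveʳ)
      (Size-Y′ N D (x ∷ E) (bound [] eq)
        (AllPairs-⊆ (⊆-refl {x = D} ⊆++ (refl ∷ b ∷ʳˢ ⊆-refl)) (subst (λ L → Sorted (D ++ t ∷ L)) eq sX)))
    sizes (l ∷ L₁) (b ∷ x ∷ E) eq = Size-map (λ u → b ∷ u ++ reverse (D ++ l ∷ L₁))
      (λ _ _ e → ++-cancelʳ _ _ _ (∷-injectiveʳ e))
      (Size-C (x ∷ E) ℕₚ.≤-refl
        (AllPairs-⊆ (⊆-++ˡ D (t ∷ʳˢ ⊆-++ˡ (l ∷ L₁) (b ∷ʳˢ ⊆-refl))) (subst (λ L → Sorted (D ++ t ∷ L)) eq sX)))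

-- Reversing both words and order is the reverse-complement without renaming letters: 213 becomes
-- 132, and 3412 is fixed. The counts for `C` thus carry over to `G`.
module Reversed = Order (Flip.isStrictTotalOrder ℕₚ.<-isStrictTotalOrder)

-- Words avoiding 1324, 3142 and 3412

record G (X w : Word) : Set where
  field
    perm   : w ↭ X
    no132  : No132 w
    no3412 : No3412 w

unreverse : {v w : Word} → reverse v ⊆ reverse w → v ⊆ w
unreverse {v} {w} = Sublistₚ.reverse⁻ {as = v} {bs = w}

Size-G : ∀ X → Sorted X → Size (G X) (countC (length X))
Size-G X sX = subst (Size (G X)) (cong countC (length-reverse X))
  (Size-⇔ to (λ gw → _ , from gw , sym (reverse-involutive _))
    (Size-map reverse (λ _ _ → reverse-injective) (Reversed.Size-C (reverse X) ℕₚ.≤-refl (AllPairs-reverse sX))))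
  where
  to : ∀ {w} → (∃ λ u → Reversed.C (reverse X) u × w ≡ reverse u) → G X w
  to (u , cu , refl) = record
    { perm   = ↭-trans (↭-reverse u) (↭-trans (Reversed.C.perm cu) (↭-reverse X))
    ; no132  = λ {x} {y} {z} s x<z z<y → Reversed.C.no213 cu (unreverse {z ∷ y ∷ x ∷ []} s) z<y x<z
    ; no3412 = λ {x} {y} {z} {t} s z<t t<x x<y →
        Reversed.C.no3412 cu (unreverse {t ∷ z ∷ y ∷ x ∷ []} s) x<y t<x z<t }
  from : ∀ {w} → G X w → Reversed.C (reverse X) (reverse w)
  from {w} gw = record
    { perm   = ↭-trans (↭-reverse w) (↭-trans (G.perm gw) (↭-sym (↭-reverse X)))
    ; no213  = λ {x} {y} {z} s x<y z<x → G.no132 gw (unreverse {z ∷ y ∷ x ∷ []} s) z<x x<y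
    ; no3412 = λ {x} {y} {z} {t} s t<z x<t y<x →
        G.no3412 gw (unreverse {t ∷ z ∷ y ∷ x ∷ []} s) y<x x<t t<z }

record A (X w : Word) : Set where
  field
    perm   : w ↭ X
    no1324 : No1324 w
    no3142 : No3142 w
    no3412 : No3412 w

A-tail : ∀ {X X′ a r} → A X (a ∷ r) → r ↭ X′ → A X′ r
A-tail aw ρ = record
  { perm = ρ ; no1324 = no1324 ∘ (_ ∷ʳˢ_) ; no3142 = no3142 ∘ (_ ∷ʳˢ_) ; no3412 = no3412 ∘ (_ ∷ʳˢ_) }
  where open A aw

No1324-∷ : ∀ {a r} → (∀ {y z t} → y ∷ z ∷ t ∷ [] ⊆ r → a < z → z < y → y < t → ⊥) → No1324 r → No1324 (a ∷ r)
No1324-∷ first av (_ ∷ʳˢ s)  = av s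
No1324-∷ first av (refl ∷ s) = first s

A-top : ∀ D {a r} → Sorted (D ++ a ∷ []) → A D r → A (D ++ a ∷ []) (a ∷ r)
A-top D {a} {r} sX ar = record
  { perm   = ∷-↭ D (subst (r ↭_) (sym (++-identityʳ D)) perm)
  ; no1324 = No1324-∷ (λ s a<z _ _ → asym a<z (<a (∈₂ s))) no1324
  ; no3142 = No3142-∷ (λ s _ _ a<z → asym a<z (<a (∈₂ s))) no3142
  ; no3412 = No3412-∷ (λ s _ _ a<y → asym a<y (<a (∈₁ s))) no3412 }
  where
  open A ar
  <a : ∀ {y} → y ∈ r → y < a
  <a y∈ = AllPairs-++⁻ sX (∈-resp-↭ perm y∈) (here refl)

-- `u` is the prefix on `P`. The class of `v` is `Z` rather than `Y` because v starts with the first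
-- letter above a; this makes the factorisation unique.
B : ℕ → Word → Word → Word → Word → Set
B a E D P r = ∃ λ ((u , v) : Word × Word) → (G P u × Z a D E v) × r ≡ u ++ v

↭-regroup : ∀ {u v : Word} D P E → u ↭ P → v ↭ D ++ E → u ++ v ↭ (D ++ P) ++ E
↭-regroup D P E ρ σ = ↭-trans (++⁺ ρ σ) (↭-trans (shifts P D) (↭-reflexive (sym (++-assoc D P E))))

-- All of `D` lies below `P`, so a rise from u into v ends above a. An occurrence crossing the
-- boundary therefore contains an ascent to a small letter in v, a 213 above a in v or a 132 in u,
-- or it puts a letter of u above a.
B⇒A : ∀ D P {a E r} → Sorted ((D ++ P) ++ a ∷ E) → B a E D P r → A ((D ++ P) ++ a ∷ E) (a ∷ r)
B⇒A D P {a} {E} sX ((u , v) , (gu , zv) , refl) = record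
  { perm   = ∷-↭ (D ++ P) (↭-regroup D P E U.perm V.perm)
  ; no1324 = No1324-∷ first1324 all1324
  ; no3142 = No3142-∷ first3142 all3142
  ; no3412 = No3412-∷ first3412 all3412 }
  where
  sDE : Sorted (D ++ a ∷ E)
  sDE = AllPairs-⊆ (⊆-++ʳ P ⊆-refl ⊆++ ⊆-refl {x = a ∷ E}) sX
  module U = G gu
  module V = Y (Z⇒Y sDE zv)
  u<a : ∀ {p} → p ∈ u → p < a
  u<a p∈ = AllPairs-++⁻ sX (∈-++⁺ʳ D (∈-resp-↭ U.perm p∈)) (here refl)
  v≶a : ∀ {x} → x ∈ v → x < a ⊎ a < x
  v≶a x∈ with ∈-++⁻ D (∈-resp-↭ V.perm x∈)
  ... | inj₁ x∈D = inj₁ (small sDE x∈D)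
  ... | inj₂ x∈E = inj₂ (large sDE x∈E)
  above : ∀ {p x} → p ∈ u → x ∈ v → p < x → a < x
  above p∈ x∈ p<x with ∈-++⁻ D (∈-resp-↭ V.perm x∈)
  ... | inj₁ x∈D = ⊥-elim (asym p<x (AllPairs-++⁻ (AllPairs-⊆ (⊆-++ʳ _ ⊆-refl) sX) x∈D (∈-resp-↭ U.perm p∈)))
  ... | inj₂ x∈E = large sDE x∈E

  first1324 : ∀ {y z t} → y ∷ z ∷ t ∷ [] ⊆ u ++ v → a < z → z < y → y < t → ⊥
  first1324 s a<z z<y y<t with ⊆-++⁻ u s
  ... | _ , _ , cut    , _  , s₂ = V.no213 s₂ a<z z<y y<t
  ... | _ , _ , next _ , s₁ , _  = asym (<-trans a<z z<y) (u<a (∈₁ s₁))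

  first3142 : ∀ {y z t} → y ∷ z ∷ t ∷ [] ⊆ u ++ v → y < t → t < a → a < z → ⊥
  first3142 s y<t t<a a<z with ⊆-++⁻ u s
  ... | _ , _ , cut             , _  , s₂ = V.small↘ (⊆-trans (refl ∷ _ ∷ʳˢ ⊆-refl) s₂) y<t t<a
  ... | _ , _ , next cut        , s₁ , s₂ = asym t<a (above (∈₁ s₁) (∈₂ s₂) y<t)
  ... | _ , _ , next (next _) , s₁ , _  = asym a<z (u<a (∈₂ s₁))

  first3412 : ∀ {y z t} → y ∷ z ∷ t ∷ [] ⊆ u ++ v → z < t → t < a → a < y → ⊥
  first3412 s z<t t<a a<y with ⊆-++⁻ u s
  ... | _ , _ , cut    , _  , s₂ = V.small↘ (drop₁ s₂) z<t t<a
  ... | _ , _ , next _ , s₁ , _  = asym a<y (u<a (∈₁ s₁))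

  all1324 : No1324 (u ++ v)
  all1324 s x<z z<y y<t with ⊆-++⁻ u s
  ... | _ , _ , next cut , s₁ , s₂ = V.no213 s₂ (above (∈₁ s₁) (∈₂ s₂) x<z) z<y y<t
  ... | _ , _ , next (next cut) , s₁ , s₂ =
    asym (<-trans (above (∈₁ s₁) (∈₁ s₂) x<z) z<y) (u<a (∈₂ s₁))
  ... | _ , _ , next (next (next _)) , s₁ , _ = U.no132 (⊆-trans (refl ∷ refl ∷ refl ∷ minimum _) s₁) x<z z<y
  -- Inside v a 213 is forbidden only above a, so the letter playing the 2 decides: below a it ends
  -- an ascent to a small letter, above a the last three letters are all large.
  ... | _ , _ , cut , _ , s₂ with v≶a (∈₃ s₂)
  ...   | inj₁ z<a = V.small↘ (⊆-trans (refl ∷ _ ∷ʳˢ refl ∷ minimum _) s₂) x<z z<a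
  ...   | inj₂ a<z = V.no213 (drop₁ s₂) a<z z<y y<t

  all3142 : No3142 (u ++ v)
  all3142 s y<t t<x x<z with ⊆-++⁻ u s
  ... | _ , _ , cut , _ , s₂ = V.no3142 s₂ y<t t<x x<z
  ... | _ , _ , next cut , s₁ , s₂ =
    V.small↘ (⊆-trans (refl ∷ _ ∷ʳˢ ⊆-refl) s₂) y<t (<-trans t<x (u<a (∈₁ s₁)))
  ... | _ , _ , next (next cut) , s₁ , s₂ =
    asym (<-trans (above (∈₂ s₁) (∈₂ s₂) y<t) t<x) (u<a (∈₁ s₁))
  ... | _ , _ , next (next (next cut)) , s₁ , s₂ =
    asym (<-trans (above (∈₂ s₁) (∈₁ s₂) y<t) t<x) (u<a (∈₁ s₁))
  ... | _ , _ , next (next (next (next cut))) , s₁ , _ = U.no132 (drop₁ s₁) y<t (<-trans t<x x<z)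

  all3412 : No3412 (u ++ v)
  all3412 s z<t t<x x<y with ⊆-++⁻ u s
  ... | _ , _ , cut , _ , s₂ = V.no3412 s₂ z<t t<x x<y
  ... | _ , _ , next cut , s₁ , s₂ = V.small↘ (drop₁ s₂) z<t (<-trans t<x (u<a (∈₁ s₁)))
  ... | _ , _ , next (next cut) , s₁ , s₂ = V.small↘ s₂ z<t (<-trans t<x (u<a (∈₁ s₁)))
  ... | _ , _ , next (next (next cut)) , s₁ , s₂ =
    asym (<-trans (above (∈₃ s₁) (∈₁ s₂) z<t) t<x) (u<a (∈₁ s₁))
  ... | _ , _ , next (next (next (next cut))) , s₁ , _ = U.no3412 s₁ z<t t<x x<y

-- Let b be the first letter above a. If p < d < a with p before b and d after it, then a p b d is a
-- 3142; so the letters below a that follow b are the lowest ones, `D`. An ascent among them gives a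
-- 3412 with a and b, a 213 above a from b on gives a 1324 with a in front, and a 132 before b gives
-- a 1324 with b behind.
A⇒B : ∀ X₁ {a x E r} → Sorted (X₁ ++ a ∷ x ∷ E) → r ↭ X₁ ++ x ∷ E → A (X₁ ++ a ∷ x ∷ E) (a ∷ r) →
      ∃₂ λ D P → X₁ ≡ D ++ P × B a (x ∷ E) D P r
A⇒B X₁ {a} {x} {E} {r} sX ρ aw with break (ℕₚ._<? a) r
... | u , .[] , refl , u<a , inj₁ refl = ⊥-elim (asym (large sX x∈) (All.lookup u<a x∈u))
  where
  x∈ : x ∈ x ∷ E
  x∈ = here refl
  x∈u : x ∈ u
  x∈u with ∈-++⁻ u (∈-resp-↭ (↭-sym ρ) (∈-++⁺ʳ X₁ x∈))
  ... | inj₁ x∈u = x∈u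
... | u , .(b ∷ v) , refl , u<a , inj₂ (b , v , refl , b≮a) =
  result (⊆-closed⇒++ (_∈? (b ∷ v)) X₁ closed)
  where
  open A aw
  r-unique : Unique (u ++ b ∷ v)
  r-unique = AllPairs.tail (Unique-resp-↭ (↭-sym perm) (Sorted⇒Unique sX))
  a<b : a < b
  a<b with ∈-++⁻ X₁ (∈-resp-↭ ρ (∈-++⁺ʳ u (here refl)))
  ... | inj₁ b∈X₁ = ⊥-elim (b≮a (small sX b∈X₁))
  ... | inj₂ b∈E  = large sX b∈E
  small⊆v : ∀ {σ d} → d ∷ σ ⊆ b ∷ v → d < a → d ∷ σ ⊆ v
  small⊆v (_ ∷ʳˢ s)  _   = s
  small⊆v (refl ∷ _) b<a = ⊥-elim (b≮a b<a)
  closed : ∀ {p d} → p ∷ d ∷ [] ⊆ X₁ → d ∈ b ∷ v → p ∈ b ∷ v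
  closed {p} {d} s d∈ with ∈-++⁻ u (∈-resp-↭ (↭-sym ρ) (∈-++⁺ˡ (∈₁ s)))
  ... | inj₂ p∈v = p∈v
  ... | inj₁ p∈u = ⊥-elim (no3142 (refl ∷ from∈ p∈u ⊆++ (refl ∷ small⊆v (from∈ d∈) d<a))
                             (AllPairs⇒⊆ (AllPairs-⊆ (⊆-++ʳ _ ⊆-refl) sX) s) d<a a<b)
    where
    d<a : d < a
    d<a = small sX (∈₂ s)
  result : (∃₂ λ D P → X₁ ≡ D ++ P × All (_∈ b ∷ v) D × All (¬_ ∘ (_∈ b ∷ v)) P) →
           ∃₂ λ D P → X₁ ≡ D ++ P × B a (x ∷ E) D P (u ++ b ∷ v)
  result (D , P , refl , D∈v , P∉v) = D , P , refl , (u , b ∷ v) ,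
    (record { perm = u↭ ; no132 = λ s x<z z<y → no1324 (a ∷ʳˢ s ⊆++ (refl ∷ minimum v)) x<z z<y
                                      (<-trans (All.lookup u<a (∈₂ s)) a<b)
            ; no3412 = no3412 ∘ (a ∷ʳˢ_) ∘ ⊆-++ʳ (b ∷ v) }
    , zv) , refl
    where
    sDE : Sorted (D ++ a ∷ x ∷ E)
    sDE = AllPairs-⊆ (⊆-++ʳ P ⊆-refl ⊆++ ⊆-refl {x = a ∷ x ∷ E}) sX
    E∈v : ∀ {e} → e ∈ x ∷ E → e ∈ b ∷ v
    E∈v e∈ with ∈-++⁻ u (∈-resp-↭ (↭-sym ρ) (∈-++⁺ʳ (D ++ P) e∈))
    ... | inj₁ e∈u = ⊥-elim (asym (large sX e∈) (All.lookup u<a e∈u))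
    ... | inj₂ e∈v = e∈v
    u∉v : ∀ {p} → p ∈ u → ¬ (p ∈ b ∷ v)
    u∉v p∈u p∈v = AllPairs-++⁻ r-unique p∈u p∈v refl
    vu↭ : (b ∷ v) ++ u ↭ (D ++ x ∷ E) ++ P
    vu↭ = ↭-trans (++-comm (b ∷ v) u) (↭-trans ρ (↭-trans (↭-reflexive (++-assoc D P (x ∷ E)))
            (↭-trans (++⁺ (↭-refl {x = D}) (++-comm P (x ∷ E))) (↭-reflexive (sym (++-assoc D (x ∷ E) P))))))
    v↭ : b ∷ v ↭ D ++ x ∷ E
    v↭ = ↭-partition (_∈? (b ∷ v)) vu↭ (All.tabulate (λ p → p)) (All.tabulate u∉v)
           (Allₚ.++⁺ D∈v (All.tabulate E∈v)) P∉v
    u↭ : u ↭ P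
    u↭ = ++-cancelˡ-↭ (b ∷ v) (↭-trans vu↭ (++⁺ (↭-sym v↭) ↭-refl))
    yv : Y a D (x ∷ E) (b ∷ v)
    yv = record
      { perm   = v↭
      ; small↘ = λ { (refl ∷ _) b<y y<a → asym (<-trans b<y y<a) a<b
                   ; (_ ∷ʳˢ s) x<y y<a → no3412 (refl ∷ ⊆-++ˡ u (refl ∷ s)) x<y y<a a<b }
      ; no213  = λ s a<y y<x x<z → no1324 (refl ∷ ⊆-++ˡ u s) a<y y<x x<z
      ; no3412 = no3412 ∘ (a ∷ʳˢ_) ∘ ⊆-++ˡ u
      ; no3142 = no3142 ∘ (a ∷ʳˢ_) ∘ ⊆-++ˡ u }
    zv : Z a D (x ∷ E) (b ∷ v)
    zv with Y⇒Small⊎Z sDE yv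
    ... | inj₂ zv = zv
    ... | inj₁ (D′ , d , refl , _ , _ , refl) = ⊥-elim (b≮a (small sDE (∈-++⁺ʳ D′ (here refl))))

A-Split : Word → Word → Word → Set
A-Split X₁ []          w = ⊥
A-Split X₁ (a ∷ [])    w = ∃ λ r → A X₁ r × w ≡ a ∷ r
A-Split X₁ (a ∷ x ∷ E) w = ∃ λ r → (∃₂ λ D P → X₁ ≡ D ++ P × B a (x ∷ E) D P r) × w ≡ a ∷ r

A⇒Split : ∀ {X w} → Sorted X → w ≢ [] → A X w → ∃₂ λ X₁ X₂ → X ≡ X₁ ++ X₂ × A-Split X₁ X₂ w
A⇒Split {w = []}    sX w≢[] aw = ⊥-elim (w≢[] refl)
A⇒Split {w = a ∷ r} sX _    aw with ↭-∷ (A.perm aw)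
... | X₁ , [] , refl , ρ = X₁ , a ∷ [] , refl , r , A-tail aw (subst (r ↭_) (++-identityʳ X₁) ρ) , refl
... | X₁ , x ∷ E , refl , ρ = X₁ , a ∷ x ∷ E , refl , r , A⇒B X₁ sX ρ aw , refl

Split⇒A : ∀ {X} X₁ X₂ {w} → Sorted X → X ≡ X₁ ++ X₂ → A-Split X₁ X₂ w → A X w
Split⇒A X₁ (a ∷ [])    sX refl (_ , ar , refl) = A-top X₁ sX ar
Split⇒A X₁ (a ∷ x ∷ E) sX refl (_ , (D , P , refl , br) , refl) = B⇒A D P sX br

A-Split-head : ∀ X₁ X₂ {w} → A-Split X₁ X₂ w → ∃₂ λ a E → X₂ ≡ a ∷ E × ∃ λ r → w ≡ a ∷ r
A-Split-head X₁ (a ∷ [])    (_ , _ , eq) = _ , _ , refl , _ , eq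
A-Split-head X₁ (a ∷ x ∷ E) (_ , _ , eq) = _ , _ , refl , _ , eq

-- Here i letters lie below the first letter and j above it. The terms with j = 0 vanish since
-- `countZ d 0` is 0, so a largest first letter is counted by the summand `countA n` alone.
countB : ℕ → ℕ
countB = convolve (λ i j → convolve (λ d p → countC p * countZ d j) i)

countA : ℕ → ℕ
countA zero    = 1
countA (suc n) = countA n + countB n

countA-split : ℕ → ℕ → ℕ
countA-split i zero          = 0
countA-split i (suc zero)    = countA i
countA-split i (suc (suc j)) = convolve (λ d p → countC p * countZ d (suc j)) i

convolve-0 : ∀ {g} → (∀ i j → g i j ≡ 0) → ∀ n → convolve g n ≡ 0
convolve-0 eq zero    = eq 0 0
convolve-0 eq (suc n) = cong₂ _+_ (eq 0 (suc n)) (convolve-0 (eq ∘ suc) n)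

countA-split-convolve : ∀ n → convolve countA-split (suc n) ≡ countA (suc n)
countA-split-convolve n = trans (convolve-last countA-split n) (step n)
  where
  step : ∀ n → convolve (λ i j → countA-split i (suc j)) n ≡ countA (suc n)
  step zero    = refl
  step (suc n) = trans (convolve-last (λ i j → countA-split i (suc j)) n) (cong (countA (suc n) +_) (sym
    (trans (convolve-last (λ i j → convolve (λ d p → countC p * countZ d j) i) n)
      (cong (_+ convolve (λ i j → countA-split i (suc (suc j))) n)
        (convolve-0 (λ _ p → ℕₚ.*-zeroʳ (countC p)) (suc n))))))

-- Either prefix ends just before the first letter above `a`, a position that depends on the whole
-- word only.
threshold-split : ∀ {a} u u′ {b b′ v v′} → (∀ {p} → p ∈ u → p < a) → (∀ {p} → p ∈ u′ → p < a) →
                  a < b → a < b′ → u ++ b ∷ v ≡ u′ ++ b′ ∷ v′ → length u ≡ length u′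
threshold-split []      []       _   _    _   _    _    = refl
threshold-split []      (_ ∷ u′) _   u′<a a<b _    refl = ⊥-elim (asym a<b (u′<a (here refl)))
threshold-split (_ ∷ u) []       u<a _    _   a<b′ refl = ⊥-elim (asym a<b′ (u<a (here refl)))
threshold-split (_ ∷ u) (_ ∷ u′) u<a u′<a a<b a<b′ eq   =
  cong suc (threshold-split u u′ (u<a ∘ there) (u′<a ∘ there) a<b a<b′ (∷-injectiveʳ eq))

-- The position of the first letter above `a` fixes the size of `P`, hence that of `D`. Within one
-- cut, u has the length of `P`, which makes concatenation injective.
Size-B : ∀ X₁ {a E} → Sorted (X₁ ++ a ∷ E) →
         Size (λ r → ∃₂ λ D P → X₁ ≡ D ++ P × B a E D P r)
              (convolve (λ d p → countC p * countZ d (length E)) (length X₁))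
Size-B X₁ {a} {E} sX = Size-splits (B a E) (λ d p → countC p * countZ d (length E)) X₁ sizes disjoint
  where
  sizes : ∀ D P → X₁ ≡ D ++ P → Size (B a E D P) (countC (length P) * countZ (length D) (length E))
  sizes D P refl = Size-map (λ (u , v) → u ++ v)
    (λ { {u , v} {u′ , v′} (gu , _) (gu′ , _) eq → let
           |u| = trans (↭-length (G.perm gu)) (sym (↭-length (G.perm gu′)))
           u≡ , v≡ = ++-injective u u′ |u| eq in cong₂ _,_ u≡ v≡ })
    (Size-× (Size-G P (AllPairs-⊆ (⊆-++ʳ _ (⊆-++ˡ D ⊆-refl)) sX))
            (Size-Z _ D E ℕₚ.≤-refl (AllPairs-⊆ (⊆-++ʳ P ⊆-refl ⊆++ ⊆-refl {x = a ∷ E}) sX)))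
  u<a : ∀ D {P u} → X₁ ≡ D ++ P → G P u → ∀ {p} → p ∈ u → p < a
  u<a D refl gu p∈ = small sX (∈-++⁺ʳ D (∈-resp-↭ (G.perm gu) p∈))
  disjoint : ∀ {D P D′ P′ r} → X₁ ≡ D ++ P → X₁ ≡ D′ ++ P′ → B a E D P r → B a E D′ P′ r →
             length D ≡ length D′
  disjoint {D} {P} {D′} {P′} eq eq′
    ((u , _) , (gu , L₁ , L₂ , E≡ , q) , refl) ((u′ , _) , (gu′ , L₁′ , L₂′ , E≡′ , q′) , r≡)
    with Z-head L₁ L₂ q | Z-head L₁′ L₂′ q′
  ... | b , _ , refl , _ , refl | b′ , _ , refl , _ , refl =
    ℕₚ.+-cancelʳ-≡ (length P) (length D) (length D′) (begin
      length D + length P    ≡⟨ length-++ D ⟨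
      length (D ++ P)        ≡⟨ cong length (trans (sym eq) eq′) ⟩
      length (D′ ++ P′)      ≡⟨ length-++ D′ ⟩
      length D′ + length P′  ≡⟨ cong (length D′ +_) |P| ⟨
      length D′ + length P   ∎)
    where
    open ≡-Reasoning
    |P| : length P ≡ length P′
    |P| = trans (sym (↭-length (G.perm gu))) (trans
      (threshold-split u u′ (u<a D eq gu) (u<a D′ eq′ gu′)
        (large sX (subst (b ∈_) (sym E≡) (∈-++⁺ʳ L₁ (here refl))))
        (large sX (subst (b′ ∈_) (sym E≡′) (∈-++⁺ʳ L₁′ (here refl)))) r≡)
      (↭-length (G.perm gu′)))

Size-A : ∀ N X → length X ≤ N → Sorted X → Size (A X) (countA (length X))
Size-A N []      _ _ = Size-⇔
  (λ { refl → record { perm = ↭-refl ; no1324 = λ () ; no3142 = λ () ; no3412 = λ () } })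
  (λ aw → ↭-empty-inv (A.perm aw)) (Size-singleton [])
Size-A (suc N) X@(x₀ ∷ X₀) (s≤s len) sX = Size-⇔
  (λ (X₁ , X₂ , eq , q) → Split⇒A X₁ X₂ sX eq q)
  (λ aw → A⇒Split sX (↭-nonempty (A.perm aw)) aw)
  (subst (Size _) (countA-split-convolve (length X₀))
    (Size-splits A-Split countA-split X sizes (split-at-head A-Split A-Split-head (Sorted⇒Unique sX))))
  where
  sizes : ∀ X₁ X₂ → X ≡ X₁ ++ X₂ → Size (A-Split X₁ X₂) (countA-split (length X₁) (length X₂))
  sizes X₁ []          eq = Size-∅ λ ()
  sizes X₁ (a ∷ [])    eq = Size-map (a ∷_) (λ _ _ → ∷-injectiveʳ)
    (Size-A N X₁
      (subst (_≤ N) (ℕₚ.suc-injective (trans (cong length eq)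
        (trans (length-++-∷ X₁) (cong suc (ℕₚ.+-identityʳ _))))) len)
      (AllPairs-⊆ (⊆-++ʳ _ ⊆-refl) (subst Sorted eq sX)))
  sizes X₁ (a ∷ x ∷ E) eq = Size-map (a ∷_) (λ _ _ → ∷-injectiveʳ) (Size-B X₁ (subst Sorted eq sX))

-- Permutations of {1, ..., n} as rearrangements of a sorted word

∈-words⁺ : ∀ {xs} w → All (_∈ xs) w → w ∈ words (length w) xs
∈-words⁺ []      []         = here refl
∈-words⁺ (x ∷ w) (x∈ ∷ w∈) = ∈-cartesianProductWith⁺ _∷_ x∈ (∈-words⁺ w w∈)

∈-words⁻ : ∀ k {xs w} → w ∈ words k xs → length w ≡ k × All (_∈ xs) w
∈-words⁻ zero         (here refl) = refl , []
∈-words⁻ (suc k) {xs} w∈ with _ , v , x∈ , v∈ , refl ← ∈-cartesianProductWith⁻ _∷_ xs (words k xs) w∈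
  with len , all ← ∈-words⁻ k {w = v} v∈ = cong suc len , x∈ ∷ all

words-Unique : ∀ k {xs} → Unique xs → Unique (words k xs)
words-Unique zero    u = [] ∷ []
words-Unique (suc k) u = Uniqueₚ.cartesianProductWith⁺ _∷_ (λ { refl → refl , refl }) u (words-Unique k u)

letters : ℕ → Word
letters n = map suc (upTo n)

letters-Sorted : ∀ n → Sorted (letters n)
letters-Sorted n = AllPairsₚ.map⁺ (AllPairsₚ.applyUpTo⁺₁ (λ i → i) n (λ i<j _ → s≤s i<j))

length-letters : ∀ n → length (letters n) ≡ n
length-letters n = trans (length-map suc (upTo n)) (length-applyUpTo (λ i → i) n)

-- Pigeonhole: n distinct letters chosen among n leave none over.
∈-permutations⁻ : ∀ {n w} → w ∈ permutations n → w ↭ letters n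
∈-permutations⁻ {n} w∈ with w∈words , u ← ∈-filter⁻ unique? {xs = words n (letters n)} w∈
  with len , all ← ∈-words⁻ n w∈words =
  Unique-⊆-length⇒↭ u (All.lookup all) (trans len (sym (length-letters n)))

∈-permutations⁺ : ∀ {n w} → w ↭ letters n → w ∈ permutations n
∈-permutations⁺ {n} {w} ρ = ∈-filter⁺ unique?
  (subst (λ k → w ∈ words k (letters n)) (trans (↭-length ρ) (length-letters n))
    (∈-words⁺ w (All.tabulate (∈-resp-↭ ρ))))
  (Unique-resp-↭ (↭-sym ρ) (Sorted⇒Unique (letters-Sorted n)))

-- Pattern containment as inequalities between letters

lookup-map : {A B : Set} (g : A → B) (xs : List A) (i : Fin (length (map g xs))) →
             lookup (map g xs) i ≡ g (lookup xs (cast (length-map g xs) i))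
lookup-map g (x ∷ xs) zero    = refl
lookup-map g (x ∷ xs) (suc i) = lookup-map g xs i

increasing : (g : ℕ → ℕ) → (∀ n → 0 < n → g n < g (suc n)) → ∀ {m n} → 0 < m → m < n → g m < g n
increasing g step {m} {suc n} 0<m m<1+n with ℕₚ.m<1+n⇒m<n∨m≡n m<1+n
... | inj₁ m<n  = <-trans (increasing g step 0<m m<n) (step n (<-trans 0<m m<n))
... | inj₂ refl = step m 0<m

-- Letters of a pattern are positive, so g 0 is irrelevant.
increasing⇒OrderIsomorphic : (g : ℕ → ℕ) → (∀ n → 0 < n → g n < g (suc n)) →
                             ∀ τ → All (0 <_) τ → OrderIsomorphic (map g τ) τ
increasing⇒OrderIsomorphic g step τ pos = length-map g τ , λ i j →
  subst₂ (λ x y → (x < y) ⇔ (at i < at j)) (sym (lookup-map g τ i)) (sym (lookup-map g τ j))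
    (iso (at i) (at j) (positive i) (positive j))
  where
  at : Fin (length (map g τ)) → ℕ
  at i = lookup τ (cast (length-map g τ) i)
  positive : ∀ i → 0 < at i
  positive i = All.lookup pos (∈-lookup (cast (length-map g τ) i))
  iso : ∀ m n → 0 < m → 0 < n → (g m < g n) ⇔ (m < n)
  iso m n 0<m 0<n = mk⇔ to (increasing g step 0<m)
    where
    to : g m < g n → m < n
    to gm<gn with ℕₚ.<-cmp m n
    ... | tri< m<n _ _  = m<n
    ... | tri≈ _ refl _ = ⊥-elim (<-irrefl refl gm<gn)
    ... | tri> _ _ n<m  = ⊥-elim (asym gm<gn (increasing g step 0<n n<m))

-- Sends the pattern letters 1 to 4 to a, b, c, d, so that `map (rank a b c d) τ` computes to the
-- occurrence of τ. From 4 on it grows in unit steps, which keeps it increasing on all positive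
-- numbers.
rank : ℕ → ℕ → ℕ → ℕ → ℕ → ℕ
rank a b c d 0 = 0
rank a b c d 1 = a
rank a b c d 2 = b
rank a b c d 3 = c
rank a b c d (suc (suc (suc (suc n)))) = n + d

rank-step : ∀ {a b c d} → a < b → b < c → c < d → ∀ n → 0 < n → rank a b c d n < rank a b c d (suc n)
rank-step a<b b<c c<d 1 _ = a<b
rank-step a<b b<c c<d 2 _ = b<c
rank-step a<b b<c c<d 3 _ = c<d
rank-step a<b b<c c<d (suc (suc (suc (suc n)))) _ = ℕₚ.n<1+n _

occurrence : ∀ {w a b c d} → a < b → b < c → c < d → ∀ τ → All (0 <_) τ →
             map (rank a b c d) τ ⊆ w → Contains w τ
occurrence a<b b<c c<d τ pos s = _ , s , increasing⇒OrderIsomorphic _ (rank-step a<b b<c c<d) τ pos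

T : List Word
T = (1 ∷ 3 ∷ 2 ∷ 4 ∷ []) ∷ (3 ∷ 1 ∷ 4 ∷ 2 ∷ []) ∷ (3 ∷ 4 ∷ 1 ∷ 2 ∷ []) ∷ []

-- The three index pairs for each pattern are the positions of its letters 1 and 2, 2 and 3, 3 and
-- 4.
A⇒Avoids : ∀ {X w} → A X w → Avoids T w
A⇒Avoids aw =
  (λ { (x ∷ y ∷ z ∷ t ∷ [] , s , refl , iso) → A.no1324 aw s
         (Equivalence.from (iso 0F 2F) (s≤s (s≤s z≤n)))
         (Equivalence.from (iso 2F 1F) (s≤s (s≤s (s≤s z≤n))))
         (Equivalence.from (iso 1F 3F) (s≤s (s≤s (s≤s (s≤s z≤n))))) })
  ∷ (λ { (x ∷ y ∷ z ∷ t ∷ [] , s , refl , iso) → A.no3142 aw s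
         (Equivalence.from (iso 1F 3F) (s≤s (s≤s z≤n)))
         (Equivalence.from (iso 3F 0F) (s≤s (s≤s (s≤s z≤n))))
         (Equivalence.from (iso 0F 2F) (s≤s (s≤s (s≤s (s≤s z≤n))))) })
  ∷ (λ { (x ∷ y ∷ z ∷ t ∷ [] , s , refl , iso) → A.no3412 aw s
         (Equivalence.from (iso 2F 3F) (s≤s (s≤s z≤n)))
         (Equivalence.from (iso 3F 0F) (s≤s (s≤s (s≤s z≤n))))
         (Equivalence.from (iso 0F 1F) (s≤s (s≤s (s≤s (s≤s z≤n))))) })
  ∷ []

Avoids⇒A : ∀ {X w} → w ↭ X → Avoids T w → A X w
Avoids⇒A ρ (av1324 ∷ av3142 ∷ av3412 ∷ []) = record
  { perm   = ρ
  ; no1324 = λ s x<z z<y y<t → av1324 (occurrence x<z z<y y<t (1 ∷ 3 ∷ 2 ∷ 4 ∷ []) positive s)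
  ; no3142 = λ s y<t t<x x<z → av3142 (occurrence y<t t<x x<z (3 ∷ 1 ∷ 4 ∷ 2 ∷ []) positive s)
  ; no3412 = λ s z<t t<x x<y → av3412 (occurrence z<t t<x x<y (3 ∷ 4 ∷ 1 ∷ 2 ∷ []) positive s) }
  where
  positive : ∀ {a b c d} → All (0 <_) (suc a ∷ suc b ∷ suc c ∷ suc d ∷ [])
  positive = s≤s z≤n ∷ s≤s z≤n ∷ s≤s z≤n ∷ s≤s z≤n ∷ []

|S| : ∀ n → length (S n T) ≡ countA n
|S| n = trans (Size-unique by-enumeration (Size-A _ (letters n) ℕₚ.≤-refl (letters-Sorted n)))
              (cong countA (length-letters n))
  where
  by-enumeration : Size (A (letters n)) (length (S n T))
  by-enumeration = record
    { elements = S n T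
    ; unique   = Uniqueₚ.filter⁺ (avoids? T)
                   (Uniqueₚ.filter⁺ unique? (words-Unique n (Sorted⇒Unique (letters-Sorted n))))
    ; sound    = λ w∈ → let w∈perms , av = ∈-filter⁻ (avoids? T) {xs = permutations n} w∈
                        in Avoids⇒A (∈-permutations⁻ w∈perms) av
    ; complete = λ aw → ∈-filter⁺ (avoids? T) (∈-permutations⁺ (A.perm aw)) (A⇒Avoids aw)
    ; count    = refl }

-- Generating functions

open import Data.Integer.Base as ℤ using (ℤ; +_; -_; 0ℤ; 1ℤ)

module Σℤ = Convolution ℤₚ.+-0-isCommutativeMonoid

-- The coefficients of H: all divisions of n into small and large letters are added up.
totalZ : ℕ → ℕ
totalZ = Σℕ.convolve countZ

module _ where
  open Σℕ using (convolve-cong; convolve-∙; convolve-comm; convolve-assoc; convolve-homo)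
  open ≡-Reasoning

  sumY⁺ sumC₂ : ℕ → ℕ
  sumY⁺ = convolve (λ i j → countY i (suc j))
  sumC₂ = convolve (λ i j → sumC j)

  sumY-suc : ∀ n → convolve countY (suc n) ≡ convolve countY n + totalZ (suc n)
  sumY-suc n = begin
    countZ 0 (suc n) + convolve (λ i j → countY i j + countZ (suc i) j) n
      ≡⟨ cong (_+_ (countZ 0 (suc n))) (convolve-∙ countY (countZ ∘ suc) n) ⟩
    countZ 0 (suc n) + (convolve countY n + convolve (countZ ∘ suc) n)
      ≡⟨ swap (countZ 0 (suc n)) (convolve countY n) _ ⟩
    convolve countY n + totalZ (suc n) ∎
    where
    swap : ∀ a b c → a + (b + c) ≡ b + (a + c)
    swap = ℕ-Solver.solve-∀

  countY-0 : ∀ k → countY k 0 ≡ 1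
  countY-0 zero    = refl
  countY-0 (suc k) = trans (ℕₚ.+-identityʳ (countY k 0)) (countY-0 k)

  sumY-last : ∀ n → convolve countY (suc n) ≡ suc (sumY⁺ n)
  sumY-last n = trans (convolve-last countY n) (cong (_+ sumY⁺ n) (countY-0 (suc n)))

  -- The two copies of the `countY` sum come from a largest and a smallest first letter. With one
  -- large letter these coincide, and `countY (suc n) 0`, which is 1, occurs once; the added 1 makes
  -- up for it.
  totalZ-2+ : ∀ n → suc (totalZ (2 + n)) ≡ convolve countY (suc n) + (convolve countY (suc n) + sumC₂ n)
  totalZ-2+ n = begin
    suc (totalZ (2 + n))
      ≡⟨ cong suc (convolve-last countZ (suc n)) ⟩
    suc (convolve (λ i j → countZ i (suc j)) (suc n))
      ≡⟨ cong suc (convolve-last (λ i j → countZ i (suc j)) n) ⟩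
    suc (countY (suc n) 0 + convolve (λ i j → countY i (suc j) + (countY i (suc j) + sumC j)) n)
      ≡⟨ cong₂ (λ a b → suc (a + b)) (countY-0 (suc n))
           (trans (convolve-∙ (λ i j → countY i (suc j)) (λ i j → countY i (suc j) + sumC j) n)
                  (cong (_+_ (sumY⁺ n)) (convolve-∙ (λ i j → countY i (suc j)) (λ i j → sumC j) n))) ⟩
    suc (1 + (sumY⁺ n + (sumY⁺ n + sumC₂ n)))
      ≡⟨ shuffle (sumY⁺ n) (sumC₂ n) ⟩
    suc (sumY⁺ n) + (suc (sumY⁺ n) + sumC₂ n)
      ≡⟨ cong (λ a → a + (a + sumC₂ n)) (sumY-last n) ⟨
    convolve countY (suc n) + (convolve countY (suc n) + sumC₂ n) ∎
    where
    shuffle : ∀ a b → suc (1 + (a + (a + b))) ≡ suc a + (suc a + b)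
    shuffle = ℕ-Solver.solve-∀

  -- The difference of `totalZ-2+` at n + 1 and at n: by `sumY-suc` the sum of `countY` grows by
  -- `totalZ (2 + n)`, and `sumC₂` grows by `sumC (suc n)`, so the sum of `countY` itself cancels.
  totalZ-recurrence : ∀ n → totalZ (2 + n) ≡ 3 * totalZ (1 + n) + sumC n
  totalZ-recurrence zero    = refl
  totalZ-recurrence (suc n) = ℕₚ.suc-injective (begin
    suc (totalZ (3 + n))
      ≡⟨ totalZ-2+ (suc n) ⟩
    convolve countY (2 + n) + (convolve countY (2 + n) + (sumC (suc n) + sumC₂ n))
      ≡⟨ cong (λ a → a + (a + (sumC (suc n) + sumC₂ n))) (sumY-suc (suc n)) ⟩
    (sumY + totalZ (2 + n)) + ((sumY + totalZ (2 + n)) + (sumC (suc n) + sumC₂ n))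
      ≡⟨ regroup sumY (totalZ (2 + n)) (sumC (suc n)) (sumC₂ n) ⟩
    (sumY + (sumY + sumC₂ n)) + (totalZ (2 + n) + totalZ (2 + n) + sumC (suc n))
      ≡⟨ cong (_+ (totalZ (2 + n) + totalZ (2 + n) + sumC (suc n))) (totalZ-2+ n) ⟨
    suc (totalZ (2 + n)) + (totalZ (2 + n) + totalZ (2 + n) + sumC (suc n))
      ≡⟨ collect (totalZ (2 + n)) (sumC (suc n)) ⟩
    suc (3 * totalZ (2 + n) + sumC (suc n)) ∎)
    where
    sumY = convolve countY (suc n)
    regroup : ∀ a b c d → (a + b) + ((a + b) + (c + d)) ≡ (a + (a + d)) + (b + b + c)
    regroup = ℕ-Solver.solve-∀
    collect : ∀ a b → suc a + (a + a + b) ≡ suc (3 * a + b)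
    collect = ℕ-Solver.solve-∀

  -- The triple sum over p + d + j = n is regrouped as p against d + j; the inner sum over d + j is
  -- then a coefficient of H.
  countB-convolve : ∀ n → countB n ≡ convolve (λ i j → countC i * totalZ j) n
  countB-convolve n = begin
    convolve (λ i j → convolve (λ d p → countC p * countZ d j) i) n
      ≡⟨ convolve-cong (λ i j → convolve-comm (λ d p → countC p * countZ d j) i) n ⟩
    convolve (λ i j → convolve (λ p d → countC p * countZ d j) i) n
      ≡⟨ convolve-assoc (λ p d j → countC p * countZ d j) n ⟩
    convolve (λ p i → convolve (λ d j → countC p * countZ d j) i) n
      ≡⟨ convolve-cong (λ p i → convolve-homo (_*_ (countC p)) (ℕₚ.*-distribˡ-+ (countC p)) countZ i) n ⟩
    convolve (λ i j → countC i * totalZ j) n ∎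

+-convolve : ∀ g n → + Σℕ.convolve g n ≡ Σℤ.convolve (λ i j → + g i j) n
+-convolve g zero    = refl
+-convolve g (suc n) = cong (ℤ._+_ (+ g 0 (suc n))) (+-convolve (g ∘ suc) n)

-- Power series as a commutative semiring

infix 4 _≐_
infixl 6 _⊕_

_≐_ : Series → Series → Set
p ≐ q = ∀ n → p n ≡ q n

_⊕_ : Series → Series → Series
(p ⊕ q) n = p n ℤ.+ q n

⊛-convolve : ∀ p q n → (p ⊛ q) n ≡ Σℤ.convolve (λ i j → p i ℤ.* q j) n
⊛-convolve p q n = trans (cong sum (map-applyUpTo (λ i → i) (λ i → p i ℤ.* q (n ∸ i)) (suc n)))
                         (go (λ i j → p i ℤ.* q j) n)
  where
  sum = foldr ℤ._+_ 0ℤ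
  go : ∀ g n → sum (applyUpTo (λ i → g i (n ∸ i)) (suc n)) ≡ Σℤ.convolve g n
  go g zero    = ℤₚ.+-identityʳ (g 0 0)
  go g (suc n) = cong (ℤ._+_ (g 0 (suc n))) (go (g ∘ suc) n)

module _ where
  open Σℤ using (convolve-cong; convolve-∙; convolve-comm; convolve-assoc; convolve-homo)
  open ≡-Reasoning

  ⊛-cong : ∀ {p p′ q q′} → p ≐ p′ → q ≐ q′ → p ⊛ q ≐ p′ ⊛ q′
  ⊛-cong {p} {p′} {q} {q′} p≐ q≐ n = begin
    (p ⊛ q) n                            ≡⟨ ⊛-convolve p q n ⟩
    Σℤ.convolve (λ i j → p i ℤ.* q j) n       ≡⟨ convolve-cong (λ i j → cong₂ ℤ._*_ (p≐ i) (q≐ j)) n ⟩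
    Σℤ.convolve (λ i j → p′ i ℤ.* q′ j) n     ≡⟨ ⊛-convolve p′ q′ n ⟨
    (p′ ⊛ q′) n                          ∎

  ⊛-comm : ∀ p q → p ⊛ q ≐ q ⊛ p
  ⊛-comm p q n = begin
    (p ⊛ q) n                        ≡⟨ ⊛-convolve p q n ⟩
    Σℤ.convolve (λ i j → p i ℤ.* q j) n   ≡⟨ convolve-comm (λ i j → p i ℤ.* q j) n ⟩
    Σℤ.convolve (λ i j → p j ℤ.* q i) n   ≡⟨ convolve-cong (λ i j → ℤₚ.*-comm (p j) (q i)) n ⟩
    Σℤ.convolve (λ i j → q i ℤ.* p j) n   ≡⟨ ⊛-convolve q p n ⟨
    (q ⊛ p) n                        ∎

  convolve-*ˡ : ∀ a g n → Σℤ.convolve (λ i j → a ℤ.* g i j) n ≡ a ℤ.* Σℤ.convolve g n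
  convolve-*ˡ a = convolve-homo (ℤ._*_ a) (ℤₚ.*-distribˡ-+ a)

  ⊛-assoc : ∀ p q r → (p ⊛ q) ⊛ r ≐ p ⊛ (q ⊛ r)
  ⊛-assoc p q r n = begin
    ((p ⊛ q) ⊛ r) n
      ≡⟨ ⊛-convolve (p ⊛ q) r n ⟩
    Σℤ.convolve (λ i l → (p ⊛ q) i ℤ.* r l) n
      ≡⟨ convolve-cong left n ⟩
    Σℤ.convolve (λ i l → Σℤ.convolve (λ a b → (p a ℤ.* q b) ℤ.* r l) i) n
      ≡⟨ convolve-assoc (λ a b l → (p a ℤ.* q b) ℤ.* r l) n ⟩
    Σℤ.convolve (λ a i → Σℤ.convolve (λ b l → (p a ℤ.* q b) ℤ.* r l) i) n
      ≡⟨ convolve-cong right n ⟩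
    Σℤ.convolve (λ a i → p a ℤ.* (q ⊛ r) i) n
      ≡⟨ ⊛-convolve p (q ⊛ r) n ⟨
    (p ⊛ (q ⊛ r)) n ∎
    where
    left : ∀ i l → (p ⊛ q) i ℤ.* r l ≡ Σℤ.convolve (λ a b → (p a ℤ.* q b) ℤ.* r l) i
    left i l = begin
      (p ⊛ q) i ℤ.* r l                              ≡⟨ ℤₚ.*-comm ((p ⊛ q) i) (r l) ⟩
      r l ℤ.* (p ⊛ q) i                              ≡⟨ cong (r l ℤ.*_) (⊛-convolve p q i) ⟩
      r l ℤ.* Σℤ.convolve (λ a b → p a ℤ.* q b) i         ≡⟨ convolve-*ˡ (r l) (λ a b → p a ℤ.* q b) i ⟨
      Σℤ.convolve (λ a b → r l ℤ.* (p a ℤ.* q b)) i       ≡⟨ convolve-cong (λ a b → ℤₚ.*-comm (r l) (p a ℤ.* q b)) i ⟩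
      Σℤ.convolve (λ a b → (p a ℤ.* q b) ℤ.* r l) i       ∎
    right : ∀ a i → Σℤ.convolve (λ b l → (p a ℤ.* q b) ℤ.* r l) i ≡ p a ℤ.* (q ⊛ r) i
    right a i = begin
      Σℤ.convolve (λ b l → (p a ℤ.* q b) ℤ.* r l) i       ≡⟨ convolve-cong (λ b l → ℤₚ.*-assoc (p a) (q b) (r l)) i ⟩
      Σℤ.convolve (λ b l → p a ℤ.* (q b ℤ.* r l)) i       ≡⟨ convolve-*ˡ (p a) (λ b l → q b ℤ.* r l) i ⟩
      p a ℤ.* Σℤ.convolve (λ b l → q b ℤ.* r l) i         ≡⟨ cong (p a ℤ.*_) (⊛-convolve q r i) ⟨
      p a ℤ.* (q ⊛ r) i                              ∎

  ⊛-distribʳ : ∀ r p q → (p ⊕ q) ⊛ r ≐ p ⊛ r ⊕ q ⊛ r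
  ⊛-distribʳ r p q n = begin
    ((p ⊕ q) ⊛ r) n
      ≡⟨ ⊛-convolve (p ⊕ q) r n ⟩
    Σℤ.convolve (λ i j → (p i ℤ.+ q i) ℤ.* r j) n
      ≡⟨ convolve-cong (λ i j → ℤₚ.*-distribʳ-+ (r j) (p i) (q i)) n ⟩
    Σℤ.convolve (λ i j → p i ℤ.* r j ℤ.+ q i ℤ.* r j) n
      ≡⟨ convolve-∙ (λ i j → p i ℤ.* r j) (λ i j → q i ℤ.* r j) n ⟩
    Σℤ.convolve (λ i j → p i ℤ.* r j) n ℤ.+ Σℤ.convolve (λ i j → q i ℤ.* r j) n
      ≡⟨ cong₂ ℤ._+_ (⊛-convolve p r n) (⊛-convolve q r n) ⟨
    (p ⊛ r ⊕ q ⊛ r) n ∎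

  poly-[]-⊛ : ∀ q → poly [] ⊛ q ≐ poly []
  poly-[]-⊛ q n = trans (⊛-convolve (poly []) q n) (convolve-*ˡ 0ℤ (λ i j → q j) n)

  poly-∷-⊛-suc : ∀ a as q n → (poly (a ∷ as) ⊛ q) (suc n) ≡ a ℤ.* q (suc n) ℤ.+ (poly as ⊛ q) n
  poly-∷-⊛-suc a as q n = trans (⊛-convolve (poly (a ∷ as)) q (suc n))
                                (cong (ℤ._+_ (a ℤ.* q (suc n))) (sym (⊛-convolve (poly as) q n)))

  ⊛-identityˡ : ∀ q → poly (1ℤ ∷ []) ⊛ q ≐ q
  ⊛-identityˡ q zero    = trans (ℤₚ.+-identityʳ (1ℤ ℤ.* q 0)) (ℤₚ.*-identityˡ (q 0))
  ⊛-identityˡ q (suc n) = trans (poly-∷-⊛-suc 1ℤ [] q n)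
    (trans (cong₂ ℤ._+_ (ℤₚ.*-identityˡ (q (suc n))) (poly-[]-⊛ q n)) (ℤₚ.+-identityʳ (q (suc n))))

-- A semiring is enough for the solver: signs occur only inside polynomials, which it treats as
-- atoms.
Series-commutativeSemiring : CommutativeSemiring 0ℓ 0ℓ
Series-commutativeSemiring = record
  { Carrier = Series ; _≈_ = _≐_ ; _+_ = _⊕_ ; _*_ = _⊛_ ; 0# = poly [] ; 1# = poly (1ℤ ∷ [])
  ; isCommutativeSemiring = Biased.isCommutativeSemiringˡ record
    { +-isCommutativeMonoid = Biased.isCommutativeMonoidˡ record
      { isSemigroup = record
        { isMagma = record
          { isEquivalence = ≐-isEquivalence
          ; ∙-cong = λ p≐ q≐ n → cong₂ ℤ._+_ (p≐ n) (q≐ n) }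
        ; assoc = λ p q r n → ℤₚ.+-assoc (p n) (q n) (r n) }
      ; identityˡ = λ p n → ℤₚ.+-identityˡ (p n)
      ; comm = λ p q n → ℤₚ.+-comm (p n) (q n) }
    ; *-isCommutativeMonoid = Biased.isCommutativeMonoidˡ record
      { isSemigroup = record
        { isMagma = record { isEquivalence = ≐-isEquivalence ; ∙-cong = ⊛-cong }
        ; assoc = ⊛-assoc }
      ; identityˡ = ⊛-identityˡ
      ; comm = ⊛-comm }
    ; distribʳ = ⊛-distribʳ
    ; zeroˡ = poly-[]-⊛ } }
  where
  ≐-isEquivalence : IsEquivalence _≐_
  ≐-isEquivalence = record
    { refl = λ _ → refl ; sym = λ p≐ n → sym (p≐ n) ; trans = λ p≐ q≐ n → trans (p≐ n) (q≐ n) }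

-- Without the clause for one-element lists, the last term would be stuck on n.
act : List ℤ → Series → Series
act []           q n       = 0ℤ
act (a ∷ [])     q n       = a ℤ.* q n
act (a ∷ b ∷ as) q zero    = a ℤ.* q 0
act (a ∷ b ∷ as) q (suc n) = a ℤ.* q (suc n) ℤ.+ act (b ∷ as) q n

-- Multiplication by a short polynomial becomes a fixed linear combination of neighbouring
-- coefficients, the shape in which the recurrences are known.
poly-⊛-act : ∀ as q → poly as ⊛ q ≐ act as q
poly-⊛-act []           q n       = poly-[]-⊛ q n
poly-⊛-act (a ∷ [])     q zero    = ℤₚ.+-identityʳ (a ℤ.* q 0)
poly-⊛-act (a ∷ [])     q (suc n) = trans (poly-∷-⊛-suc a [] q n)
  (trans (cong (ℤ._+_ (a ℤ.* q (suc n))) (poly-[]-⊛ q n)) (ℤₚ.+-identityʳ (a ℤ.* q (suc n))))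
poly-⊛-act (a ∷ b ∷ as) q zero    = ℤₚ.+-identityʳ (a ℤ.* q 0)
poly-⊛-act (a ∷ b ∷ as) q (suc n) =
  trans (poly-∷-⊛-suc a (b ∷ as) q n) (cong (ℤ._+_ (a ℤ.* q (suc n))) (poly-⊛-act (b ∷ as) q n))

-- Polynomial arithmetic on coefficient lists

_+ₚ_ : List ℤ → List ℤ → List ℤ
[]       +ₚ bs       = bs
(a ∷ as) +ₚ []       = a ∷ as
(a ∷ as) +ₚ (b ∷ bs) = a ℤ.+ b ∷ as +ₚ bs

_*ₚ_ : List ℤ → List ℤ → List ℤ
[]       *ₚ bs = []
(a ∷ as) *ₚ bs = map (a ℤ.*_) bs +ₚ (0ℤ ∷ as *ₚ bs)

poly-⊕ : ∀ as bs → poly as ⊕ poly bs ≐ poly (as +ₚ bs)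
poly-⊕ []       bs       n       = ℤₚ.+-identityˡ (poly bs n)
poly-⊕ (a ∷ as) []       n       = ℤₚ.+-identityʳ (poly (a ∷ as) n)
poly-⊕ (a ∷ as) (b ∷ bs) zero    = refl
poly-⊕ (a ∷ as) (b ∷ bs) (suc n) = poly-⊕ as bs n

poly-map : ∀ a bs n → a ℤ.* poly bs n ≡ poly (map (a ℤ.*_) bs) n
poly-map a []       n       = ℤₚ.*-zeroʳ a
poly-map a (b ∷ bs) zero    = refl
poly-map a (b ∷ bs) (suc n) = poly-map a bs n

poly-⊛ : ∀ as bs → poly as ⊛ poly bs ≐ poly (as *ₚ bs)
poly-⊛ []       bs n = poly-[]-⊛ (poly bs) n
poly-⊛ (a ∷ as) bs n = trans (expand n) (poly-⊕ (map (a ℤ.*_) bs) (0ℤ ∷ as *ₚ bs) n)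
  where
  expand : ∀ n → (poly (a ∷ as) ⊛ poly bs) n ≡ poly (map (a ℤ.*_) bs) n ℤ.+ poly (0ℤ ∷ as *ₚ bs) n
  expand zero    = cong (ℤ._+ 0ℤ) (poly-map a bs 0)
  expand (suc n) = trans (poly-∷-⊛-suc a as (poly bs) n) (cong₂ ℤ._+_ (poly-map a bs (suc n)) (poly-⊛ as bs n))

-- The equations for C, S, H and F

1-x 1-2x 1-3x 1-3x+x² X X² : List ℤ
1-x     = + 1 ∷ - (+ 1) ∷ []
1-2x    = + 1 ∷ - (+ 2) ∷ []
1-3x    = + 1 ∷ - (+ 3) ∷ []
1-3x+x² = + 1 ∷ - (+ 3) ∷ + 1 ∷ []
X       = + 0 ∷ + 1 ∷ []
X²      = + 0 ∷ + 0 ∷ + 1 ∷ []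

C̃ S̃ H̃ F̃ : Series
C̃ n = + countC n
S̃ n = + sumC n
H̃ n = + totalZ n
F̃ n = + countA n

-- From degree 2 on, three consecutive coefficients unfold to linear expressions in `countC n` and
-- `sumC n`, which cancel. The equation for S is checked alike.
C-equation : poly 1-3x+x² ⊛ C̃ ≐ poly 1-2x
C-equation n = trans (poly-⊛-act 1-3x+x² C̃ n) (go n)
  where
  identity : ∀ a b → 1ℤ ℤ.* ((a ℤ.+ b) ℤ.+ (b ℤ.+ (a ℤ.+ b))) ℤ.+ ((- (+ 3)) ℤ.* (a ℤ.+ b) ℤ.+ 1ℤ ℤ.* a) ≡ 0ℤ
  identity = ℤ-Solver.solve-∀
  go : act 1-3x+x² C̃ ≐ poly 1-2x
  go 0             = refl
  go 1             = refl
  go (suc (suc n)) = identity (+ countC n) (+ sumC n)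

S-equation : poly 1-3x+x² ⊛ S̃ ≐ poly X
S-equation n = trans (poly-⊛-act 1-3x+x² S̃ n) (go n)
  where
  identity : ∀ a b → let b′ = b ℤ.+ (a ℤ.+ b) in
    1ℤ ℤ.* (b′ ℤ.+ ((a ℤ.+ b) ℤ.+ b′)) ℤ.+ ((- (+ 3)) ℤ.* b′ ℤ.+ 1ℤ ℤ.* b) ≡ 0ℤ
  identity = ℤ-Solver.solve-∀
  go : act 1-3x+x² S̃ ≐ poly X
  go 0             = refl
  go 1             = refl
  go (suc (suc n)) = identity (+ countC n) (+ sumC n)

H-equation : poly 1-3x ⊛ H̃ ≐ poly X ⊕ poly X² ⊛ S̃
H-equation n = trans (poly-⊛-act 1-3x H̃ n) (trans (go n) (cong (ℤ._+_ (poly X n)) (sym (poly-⊛-act X² S̃ n))))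
  where
  identity : ∀ a b → 1ℤ ℤ.* ((+ 3) ℤ.* a ℤ.+ b) ℤ.+ (- (+ 3)) ℤ.* a ≡ 0ℤ ℤ.+ (0ℤ ℤ.+ (0ℤ ℤ.+ 1ℤ ℤ.* b))
  identity = ℤ-Solver.solve-∀
  go : ∀ n → act 1-3x H̃ n ≡ poly X n ℤ.+ act X² S̃ n
  go 0 = refl
  go 1 = refl
  go (suc (suc n)) = trans
    (cong (λ x → 1ℤ ℤ.* x ℤ.+ (- (+ 3)) ℤ.* H̃ (suc n))
      (trans (cong +_ (totalZ-recurrence n)) (cong (ℤ._+ + sumC n) (ℤₚ.pos-* 3 (totalZ (suc n))))))
    (identity (H̃ (suc n)) (+ sumC n))

F-equation : poly 1-x ⊛ F̃ ≐ poly (1ℤ ∷ []) ⊕ poly X ⊛ (C̃ ⊛ H̃)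
F-equation n = trans (poly-⊛-act 1-x F̃ n) (trans (go n)
  (cong (ℤ._+_ (poly (1ℤ ∷ []) n)) (sym (poly-⊛-act X (C̃ ⊛ H̃) n))))
  where
  identity : ∀ a b → 1ℤ ℤ.* (a ℤ.+ b) ℤ.+ (- 1ℤ) ℤ.* a ≡ 0ℤ ℤ.+ (0ℤ ℤ.+ 1ℤ ℤ.* b)
  identity = ℤ-Solver.solve-∀
  +t : ∀ n → + countB n ≡ (C̃ ⊛ H̃) n
  +t n = begin
    + countB n                                       ≡⟨ cong +_ (countB-convolve n) ⟩
    + Σℕ.convolve (λ i j → countC i * totalZ j) n       ≡⟨ +-convolve (λ i j → countC i * totalZ j) n ⟩
    Σℤ.convolve (λ i j → + (countC i * totalZ j)) n     ≡⟨ Σℤ.convolve-cong (λ i j → ℤₚ.pos-* (countC i) (totalZ j)) n ⟩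
    Σℤ.convolve (λ i j → C̃ i ℤ.* H̃ j) n         ≡⟨ ⊛-convolve C̃ H̃ n ⟨
    (C̃ ⊛ H̃) n                                   ∎
    where open ≡-Reasoning
  go : ∀ n → act 1-x F̃ n ≡ poly (1ℤ ∷ []) n ℤ.+ act X (C̃ ⊛ H̃) n
  go zero    = refl
  go (suc n) = trans (identity (+ countA n) (+ countB n)) (cong (λ x → 0ℤ ℤ.+ (0ℤ ℤ.+ 1ℤ ℤ.* x)) (+t n))

⊕-congˡ : ∀ p {q q′} → q ≐ q′ → p ⊕ q ≐ p ⊕ q′
⊕-congˡ p q≐ n = cong (ℤ._+_ (p n)) (q≐ n)

⊛-congˡ : ∀ p {q q′} → q ≐ q′ → p ⊛ q ≐ p ⊛ q′
⊛-congˡ p = ⊛-cong {p = p} (λ _ → refl)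

numerator : List ℤ
numerator = + 1 ∷ - (+ 9) ∷ + 30 ∷ - (+ 44) ∷ + 27 ∷ - (+ 7) ∷ []

-- The left side is what remains after C, H and S have been eliminated. Once it is multiplied out on
-- coefficient lists, the degrees are compared one by one.
numerator-expansion :
  poly 1-3x ⊛ (poly 1-3x+x² ⊛ poly 1-3x+x²) ⊕ poly X ⊛ (poly 1-2x ⊛ (poly 1-3x+x² ⊛ poly X ⊕ poly X² ⊛ poly X))
  ≐ poly numerator
numerator-expansion = begin
  poly 1-3x ⊛ (poly 1-3x+x² ⊛ poly 1-3x+x²) ⊕ poly X ⊛ (poly 1-2x ⊛ (poly 1-3x+x² ⊛ poly X ⊕ poly X² ⊛ poly X))
    ≈⟨ +-cong
         (⊛-congˡ (poly 1-3x) (poly-⊛ 1-3x+x² 1-3x+x²))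
         (⊛-congˡ (poly X) (⊛-congˡ (poly 1-2x)
           (≐-trans (+-cong (poly-⊛ 1-3x+x² X) (poly-⊛ X² X)) (poly-⊕ (1-3x+x² *ₚ X) (X² *ₚ X))))) ⟩
  poly 1-3x ⊛ poly D² ⊕ poly X ⊛ (poly 1-2x ⊛ poly E)
    ≈⟨ +-cong (poly-⊛ 1-3x D²) (≐-trans (⊛-congˡ (poly X) (poly-⊛ 1-2x E)) (poly-⊛ X (1-2x *ₚ E))) ⟩
  poly (1-3x *ₚ D²) ⊕ poly (X *ₚ (1-2x *ₚ E))
    ≈⟨ poly-⊕ (1-3x *ₚ D²) (X *ₚ (1-2x *ₚ E)) ⟩
  poly ((1-3x *ₚ D²) +ₚ (X *ₚ (1-2x *ₚ E)))
    ≈⟨ coefficients ⟩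
  poly numerator ∎
  where
  open CommutativeSemiring Series-commutativeSemiring using (+-cong; setoid) renaming (trans to ≐-trans)
  open SetoidReasoning setoid
  D² E : List ℤ
  D² = 1-3x+x² *ₚ 1-3x+x²
  E  = (1-3x+x² *ₚ X) +ₚ (X² *ₚ X)
  coefficients : poly ((1-3x *ₚ D²) +ₚ (X *ₚ (1-2x *ₚ E))) ≐ poly numerator
  coefficients 0 = refl
  coefficients 1 = refl
  coefficients 2 = refl
  coefficients 3 = refl
  coefficients 4 = refl
  coefficients 5 = refl
  coefficients 6 = refl
  coefficients 7 = refl
  coefficients 8 = refl
  coefficients 9 = refl
  coefficients (suc (suc (suc (suc (suc (suc (suc (suc (suc (suc n)))))))))) = refl

-- Each factor of the denominator clears one series: 1 - x clears F, 1 - 3x clears H, one factor 1 -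
-- 3x + x² clears C and the other the S inside H. Hence the square.
F-closed-form : (poly 1-3x ⊛ poly 1-x ⊛ poly 1-3x+x² ^ 2) ⊛ F̃ ≐ poly numerator
F-closed-form = begin
  (a ⊛ b ⊛ (d ⊛ (d ⊛ one))) ⊛ F̃
    ≈⟨ solve 4 (λ a b d f → (a :* b :* (d :* (d :* con 1))) :* f := (a :* (d :* d)) :* (b :* f)) refl′ a b d F̃ ⟩
  (a ⊛ (d ⊛ d)) ⊛ (b ⊛ F̃)
    ≈⟨ ⊛-congˡ (a ⊛ (d ⊛ d)) F-equation ⟩
  (a ⊛ (d ⊛ d)) ⊛ (one ⊕ x ⊛ (C̃ ⊛ H̃))
    ≈⟨ solve 5 (λ a d x c h → (a :* (d :* d)) :* (con 1 :+ x :* (c :* h))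
                            := a :* (d :* d) :+ x :* ((d :* c) :* (d :* (a :* h)))) refl′ a d x C̃ H̃ ⟩
  a ⊛ (d ⊛ d) ⊕ x ⊛ ((d ⊛ C̃) ⊛ (d ⊛ (a ⊛ H̃)))
    ≈⟨ ⊕-congˡ (a ⊛ (d ⊛ d)) (⊛-congˡ x (*-cong C-equation (⊛-congˡ d H-equation))) ⟩
  a ⊛ (d ⊛ d) ⊕ x ⊛ (m ⊛ (d ⊛ (x ⊕ x² ⊛ S̃)))
    ≈⟨ solve 6 (λ a d x m x² s → a :* (d :* d) :+ x :* (m :* (d :* (x :+ x² :* s)))
                              := a :* (d :* d) :+ x :* (m :* (d :* x :+ x² :* (d :* s)))) refl′ a d x m x² S̃ ⟩
  a ⊛ (d ⊛ d) ⊕ x ⊛ (m ⊛ (d ⊛ x ⊕ x² ⊛ (d ⊛ S̃)))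
    ≈⟨ ⊕-congˡ (a ⊛ (d ⊛ d)) (⊛-congˡ x (⊛-congˡ m (⊕-congˡ (d ⊛ x) (⊛-congˡ x² S-equation)))) ⟩
  a ⊛ (d ⊛ d) ⊕ x ⊛ (m ⊛ (d ⊛ x ⊕ x² ⊛ x))
    ≈⟨ numerator-expansion ⟩
  poly numerator ∎
  where
  open CommutativeSemiring Series-commutativeSemiring using (*-cong; setoid) renaming (refl to refl′)
  open SetoidReasoning setoid
  open SemiringSolver Series-commutativeSemiring using (solve; _:=_; _:*_; _:+_; con)
  a b d m x x² one : Series
  a   = poly 1-3x
  b   = poly 1-x
  d   = poly 1-3x+x²
  m   = poly 1-2x
  x   = poly X
  x²  = poly X²
  one = poly (1ℤ ∷ [])

theorem12 : F ( (1 ∷ 3 ∷ 2 ∷ 4 ∷ [])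
    ∷ (3 ∷ 1 ∷ 4 ∷ 2 ∷ [])
    ∷ (3 ∷ 4 ∷ 1 ∷ 2 ∷ [])
    ∷ [] )
    ≈ poly (+ 1 ∷ - (+ 9) ∷ + 30 ∷ - (+ 44) ∷ + 27 ∷ - (+ 7) ∷ [])
    ÷ (poly (+ 1 ∷ - (+ 3) ∷ [])
    ⊛ poly (+ 1 ∷ - (+ 1) ∷ [])
    ⊛ poly (+ 1 ∷ - (+ 3) ∷ + 1 ∷ []) ^ 2)
theorem12 = refl , λ n →
  trans (⊛-congˡ (poly 1-3x ⊛ poly 1-x ⊛ poly 1-3x+x² ^ 2) (λ n → cong +_ (|S| n)) n)
        (F-closed-form n)
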